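{- Let $H$ be a graph and $v$ a vertex of $H$. Set $h=|E(H-v)|$, and let $\alpha$ be the number of isolated vertices of $H-v$. Then for every graph $G$ that does not contain $H$ as a minor and every positive integer $r$, we have \[ \mathrm{col}_r(G)\le h\cdot(2r+1)+\alpha . \]
   Context: All graphs are finite, undirected and simple. For a linear order $L$ of $V(G)$ and vertices $u,v$, $u$ is strongly $r$-reachable from $v$ with respect to $L$ if there is a path of length $\ell$, $0\le \ell\le r$, between $u$ and $v$ such that $u\le_L v$ and every inner vertex $w$ of the path satisfies $v<_L w$. Let $\mathrm{SReach}_r[G,L,v]$ be the set of vertices strongly $r$-reachable from $v$ (it contains $v$). The $r$-colouring number is $\mathrm{col}_r(G)=\min_{L}\max_{v\in V(G)}|\mathrm{SReach}_r[G,L,v]|$, the minimum over all linear orders $L$ of $V(G)$. -}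

module Defs where

open import Data.Nat using (ℕ; zero; suc; _+_; _*_; _≤_; _<_)
open import Data.Bool using (Bool; true; false; _∧_; _∨_; not; if_then_else_)
open import Data.Fin using (Fin; toℕ; zero; suc; fromℕ; inject₁)
open import Data.Fin.Properties using (_≟_)
open import Data.Fin.Permutation using (Permutation′; _⟨$⟩ʳ_)
open import Data.List using (List; []; _∷_; map; allFin)
open import Data.Nat.ListAction using (sum)
open import Data.Bool.ListAction using (all)
open import Data.Maybe using (Maybe; just; nothing)
open import Data.Product using (Σ; ∃; _×_; _,_)
open import Relation.Nullary.Decidable using (⌊_⌋)
open import Relation.Binary.PropositionalEquality using (_≡_)
open import Function.Definitions using (Injective)

record Graph : Set where
  field
    n      : ℕ
    adj    : Fin n → Fin n → Bool
    sym    : ∀ i j → adj i j ≡ adj j i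
    irrefl : ∀ i → adj i i ≡ false

open Graph public

Adj : (G : Graph) → Fin (n G) → Fin (n G) → Set
Adj G x y = adj G x y ≡ true

b2n : Bool → ℕ
b2n true  = 1
b2n false = 0

_≠ᵇ_ : ∀ {k} → Fin k → Fin k → Bool
i ≠ᵇ j = not ⌊ i ≟ j ⌋

_<ᵇF_ : ∀ {k} → Fin k → Fin k → Bool
i <ᵇF j = Data.Nat._<ᵇ_ (toℕ i) (toℕ j)

edgesMinus : (H : Graph) → Fin (n H) → ℕ
edgesMinus H v =
  sum (map (λ i → sum (map (λ j →
        b2n ((i <ᵇF j) ∧ adj H i j ∧ (i ≠ᵇ v) ∧ (j ≠ᵇ v)))
      (allFin (n H)))) (allFin (n H)))

isolatedMinus : (H : Graph) → Fin (n H) → ℕ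
isolatedMinus H v =
  sum (map (λ u → b2n ((u ≠ᵇ v) ∧
        all (λ w → not (adj H u w) ∨ not (w ≠ᵇ v)) (allFin (n H))))
      (allFin (n H)))

data WalkIn (G : Graph) (P : Fin (n G) → Set) : Fin (n G) → Fin (n G) → Set where
  stay : ∀ {x} → P x → WalkIn G P x x
  step : ∀ {x y z} → P x → Adj G x y → WalkIn G P y z → WalkIn G P x z

-- A minor model of H in G: a partial map f : V(G) → V(H); the branch set of
-- i ∈ V(H) is f⁻¹(i).  Branch sets are disjoint by construction, must be
-- nonempty and connected in G, and every edge of H must be realised by an
-- edge of G between the corresponding branch sets.
record MinorModel (H G : Graph) : Set where
  field
    f         : Fin (n G) → Maybe (Fin (n H))
    nonempty  : ∀ i → ∃ λ x → f x ≡ just i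
    connected : ∀ i x y → f x ≡ just i → f y ≡ just i →
                WalkIn G (λ z → f z ≡ just i) x y
    edges     : ∀ i j → Adj H i j →
                ∃ λ x → ∃ λ y → f x ≡ just i × f y ≡ just j × Adj G x y

IsMinor : Graph → Graph → Set
IsMinor H G = MinorModel H G

-- a linear order L on V(G) is given by a bijection pos : V(G) → {0,..,n-1}
LinOrder : Graph → Set
LinOrder G = Permutation′ (n G)

_≤[_]_ : ∀ {G : Graph} → Fin (n G) → LinOrder G → Fin (n G) → Set
x ≤[ L ] y = toℕ (L ⟨$⟩ʳ x) ≤ toℕ (L ⟨$⟩ʳ y)

_<[_]_ : ∀ {G : Graph} → Fin (n G) → LinOrder G → Fin (n G) → Set
x <[ L ] y = toℕ (L ⟨$⟩ʳ x) < toℕ (L ⟨$⟩ʳ y)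

record Path (G : Graph) (ℓ : ℕ) : Set where
  field
    vtx  : Fin (suc ℓ) → Fin (n G)
    inj  : Injective _≡_ _≡_ vtx
    cons : ∀ (i : Fin ℓ) → Adj G (vtx (inject₁ i)) (vtx (suc i))

open Path public

SReach : (r : ℕ) (G : Graph) (L : LinOrder G) (v u : Fin (n G)) → Set
SReach r G L v u =
  Σ ℕ λ ℓ → ℓ ≤ r × Σ (Path G ℓ) λ p →
    vtx p zero ≡ v × vtx p (fromℕ ℓ) ≡ u ×
    _≤[_]_ {G} u L v ×
    (∀ (i : Fin (suc ℓ)) → 0 < toℕ i → toℕ i < ℓ → _<[_]_ {G} v L (vtx p i))

CardLe : ∀ {m} → (Fin m → Set) → ℕ → Set
CardLe {m} P k = ∀ (s : ℕ) (g : Fin s → Fin m) → Injective _≡_ _≡_ g →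
                 (∀ i → P (g i)) → s ≤ k

ColLe : (r : ℕ) (G : Graph) (k : ℕ) → Set
ColLe r G k = Σ (LinOrder G) λ L → ∀ v → CardLe (SReach r G L v) k

{-# OPTIONS --safe #-}

-- Place the vertices of G in stages. For a component C of the unplaced vertices, maintain
-- a model of part of H − v outside C: disjoint connected cores, one for each vertex k of
-- H − v already present, such that core k has a single vertex q k adjacent to C, and for
-- some edges kl of H − v a track, a path between core k and core l that is isometric
-- through C; all neighbours of C are vertices q k or lie on tracks. If a vertex k has no
-- core, any vertex of C becomes one; if an edge kl has no track, a shortest path from q k
-- to q l through C becomes one; otherwise H is a minor, with C as the branch set of v.
-- For a component C′ of what remains of C, a core whose q k has lost contact with C′
-- swallows a track at k up to its first vertex adjacent to C′; if no track at k has such a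
-- vertex, then k is dropped together with its tracks, none of which is adjacent to C′.
-- A vertex of C reaches at most 2r+1 vertices of a track within r steps, and a vertex q k
-- on none of the tracks at k belongs to an edge without a track or to an isolated vertex
-- of H − v.

module Submission where

open import Defs
open import Data.Bool using (Bool; true; false; _∧_; _∨_; not; if_then_else_)
open import Data.Bool.ListAction using (all)
import Data.Bool.Properties as Bool
open import Data.Fin as Fin using (Fin; toℕ; zero; suc; fromℕ; fromℕ<; inject₁; punchOut)
import Data.Fin.Properties as Fin
open import Data.Fin.Permutation using (Permutation′; permutation; _⟨$⟩ʳ_)
open import Data.Fin.Subset using (∣_∣)
open import Data.Fin.Subset.Properties using (p⊂q⇒∣p∣<∣q∣; ∣p∣≤n)
open import Data.List using (List; []; _∷_; _++_; map; length; allFin; upTo; concatMap)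
open import Data.List.Membership.Propositional using (_∈_; lose)
open import Data.List.Membership.Propositional.Properties
  using (∈-++⁺ˡ; ∈-++⁺ʳ; ∈-concatMap⁺; ∈-map⁺; ∈-allFin; ∈-upTo⁺)
open import Data.List.Membership.Setoid.Properties using (index-injective)
open import Data.List.Properties using (length-++; length-map; length-upTo; map-cong)
open import Data.List.Relation.Unary.Any using (here; there; index)
open import Data.Maybe using (Maybe; just; nothing)
open import Data.Nat
open import Data.Nat.DivMod using (_%_; m≡m%n+[m/n]*n; m%n<n)
open import Data.Nat.ListAction using (sum)
open import Data.Nat.Properties
open import Data.Product using (Σ; ∃; _×_; _,_; proj₁; proj₂)
open import Data.Product.Properties using (≡-dec)
open import Data.Sum using (_⊎_; inj₁; inj₂)
open import Data.Sum.Properties using (inj₁-injective)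
open import Data.Vec using (tabulate)
open import Data.Vec.Properties using (lookup∘tabulate; lookup⇒[]=; []=⇒lookup)
open import Function using (_∘_)
open import Function.Bundles using (Equivalence)
open import Function.Definitions using (Injective)
open import Relation.Binary.Definitions using (DecidableEquality; tri<; tri≈; tri>)
open import Relation.Binary.PropositionalEquality
  using (_≡_; _≢_; refl; trans; cong; cong₂; subst; subst₂; setoid; module ≡-Reasoning)
  renaming (sym to ≡-sym)
open import Relation.Nullary using (¬_; Dec; yes; no; contradiction)
open import Relation.Nullary.Decidable using (⌊_⌋; _×-dec_; _⊎-dec_; ¬?; map′)

-- Booleans and overridden functions.

∧-true : ∀ {a b} → a ∧ b ≡ true → a ≡ true × b ≡ true
∧-true {true} {true} _ = refl , refl

≢true⇒≡false : ∀ {b} → ¬ b ≡ true → b ≡ false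
≢true⇒≡false {false} _ = refl
≢true⇒≡false {true} h = contradiction refl h

true≢false : ∀ {b} → b ≡ true → ¬ b ≡ false
true≢false refl ()

⌊⌋-true : ∀ {A : Set} (d : Dec A) → A → ⌊ d ⌋ ≡ true
⌊⌋-true (yes _) _ = refl
⌊⌋-true (no ¬a) a = contradiction a ¬a

⌊⌋-false : ∀ {A : Set} (d : Dec A) → ¬ A → ⌊ d ⌋ ≡ false
⌊⌋-false (yes a) ¬a = contradiction a ¬a
⌊⌋-false (no _) _ = refl

⌊⌋-true⁻¹ : ∀ {A : Set} (d : Dec A) → ⌊ d ⌋ ≡ true → A
⌊⌋-true⁻¹ (yes a) _ = a

⌊⌋-false⁻¹ : ∀ {A : Set} (d : Dec A) → ⌊ d ⌋ ≡ false → ¬ A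
⌊⌋-false⁻¹ (no ¬a) _ = ¬a

all-or-counterexample : ∀ {A : Set} (f : A → Bool) xs → all f xs ≡ true ⊎ ∃ λ x → f x ≡ false
all-or-counterexample f [] = inj₁ refl
all-or-counterexample f (x ∷ xs) with f x in eq
... | false = inj₂ (x , eq)
... | true = all-or-counterexample f xs

override : {A B : Set} → (A → Bool) → B → (A → B) → A → B
override P b f x = if P x then b else f x

module _ {A B : Set} (P : A → Bool) (b : B) (f : A → B) where

  override-inv : ∀ x {y} → override P b f x ≡ y →
                 (P x ≡ true × b ≡ y) ⊎ (P x ≡ false × f x ≡ y)
  override-inv x eq with P x
  ... | true  = inj₁ (refl , eq)
  ... | false = inj₂ (refl , eq)

  override-in : ∀ {x} → P x ≡ true → override P b f x ≡ b
  override-in eq rewrite eq = refl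

  override-out : ∀ {x} → P x ≡ false → override P b f x ≡ f x
  override-out eq rewrite eq = refl

module Update {A : Set} (_≟ᴬ_ : DecidableEquality A) where

  upd : {B : Set} → A → B → (A → B) → A → B
  upd a = override (λ x → ⌊ x ≟ᴬ a ⌋)

  module _ {B : Set} (a : A) (b : B) (f : A → B) where

    upd-inv : ∀ x {y} → upd a b f x ≡ y → (x ≡ a × b ≡ y) ⊎ (x ≢ a × f x ≡ y)
    upd-inv x eq with override-inv (λ x → ⌊ x ≟ᴬ a ⌋) b f x eq
    ... | inj₁ (p , e) = inj₁ (⌊⌋-true⁻¹ (x ≟ᴬ a) p , e)
    ... | inj₂ (p , e) = inj₂ (⌊⌋-false⁻¹ (x ≟ᴬ a) p , e)

    upd-same : upd a b f a ≡ b
    upd-same = override-in (λ x → ⌊ x ≟ᴬ a ⌋) b f (⌊⌋-true (a ≟ᴬ a) refl)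

    upd-other : ∀ {x} → x ≢ a → upd a b f x ≡ f x
    upd-other {x} ne = override-out (λ x → ⌊ x ≟ᴬ a ⌋) b f (⌊⌋-false (x ≟ᴬ a) ne)

-- Minima, cardinalities and linear orders on finite sets.

least : {Q : ℕ → Set} → (∀ m → Dec (Q m)) → ∀ m → Q m →
        ∃ λ k → Q k × (∀ j → Q j → k ≤ j)
least Q? zero q = zero , q , λ _ _ → z≤n
least Q? (suc m) q with Q? zero
... | yes q₀ = zero , q₀ , λ _ _ → z≤n
... | no ¬q₀ with least (Q? ∘ suc) m q
...   | k , qk , min = suc k , qk , λ where
        zero q₀ → contradiction q₀ ¬q₀
        (suc j) qj → s≤s (min j qj)

∥_∥ : ∀ {m} → (Fin m → Bool) → ℕ
∥ U ∥ = ∣ tabulate U ∣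

∥∥-strict : ∀ {m} (U U′ : Fin m → Bool) → (∀ x → U′ x ≡ true → U x ≡ true) →
            ∀ y → U y ≡ true → U′ y ≡ false → ∥ U′ ∥ < ∥ U ∥
∥∥-strict U U′ sub y uy u′y = p⊂q⇒∣p∣<∣q∣ {p = tabulate U′} {q = tabulate U}
  ( (λ {x} x∈ → lookup⇒[]= x _ (trans (lookup∘tabulate U x)
      (sub x (trans (≡-sym (lookup∘tabulate U′ x)) ([]=⇒lookup x∈)))))
  , y
  , lookup⇒[]= y _ (trans (lookup∘tabulate U y) uy)
  , λ y∈ → true≢false (trans (≡-sym (lookup∘tabulate U′ y)) ([]=⇒lookup y∈)) u′y )

-- Deleting a missed value from the codomain would inject a set of size `suc m` into one of size
-- `m`.
injective⇒surjective : ∀ {m} (f : Fin m → Fin m) → Injective _≡_ _≡_ f →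
                       ∀ y → ∃ λ x → f x ≡ y
injective⇒surjective {suc m} f f-inj y with Fin.any? (λ x → f x Fin.≟ y)
... | yes hit = hit
... | no miss = contradiction
  (Fin.injective⇒≤ {f = λ x → punchOut (λ e → miss (x , ≡-sym e))}
    (λ {a} {b} → f-inj ∘ Fin.punchOut-injective (λ e → miss (a , ≡-sym e)) (λ e → miss (b , ≡-sym e))))
  1+n≰n

-- Vertices are ranked by the number of smaller keys; the keys are distinct and respect `t`, so the
-- rank is a bijection.
linear-extension : ∀ {m} (t : Fin m → ℕ) → Σ (Permutation′ m) λ L →
  ∀ x y → toℕ (L ⟨$⟩ʳ x) ≤ toℕ (L ⟨$⟩ʳ y) → t x ≤ t y
linear-extension {m} t = permutation rank (proj₁ ∘ surj) (proj₂ ∘ surj)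
    (λ x → rank-inj (proj₂ (surj (rank x))))
  , λ x y le → ≮⇒≥ (λ ty<tx → <⇒≱ (key-mono ty<tx) (rank⇒key x y le))
  where
  key : Fin m → ℕ
  -- Lexicographic order coded as a number: `toℕ x` is below `m`, so it only breaks ties in `t`.
  key x = t x * m + toℕ x
  key-mono : ∀ {x y} → t x < t y → key x < key y
  key-mono {x} {y} lt = begin-strict
    t x * m + toℕ x <⟨ +-monoʳ-< (t x * m) (Fin.toℕ<n x) ⟩
    t x * m + m     ≡⟨ +-comm (t x * m) m ⟩
    suc (t x) * m   ≤⟨ *-monoˡ-≤ m lt ⟩
    t y * m         ≤⟨ m≤m+n _ _ ⟩
    key y           ∎
    where open ≤-Reasoning
  key-inj : ∀ {x y} → key x ≡ key y → x ≡ y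
  key-inj {x} {y} eq with <-cmp (t x) (t y)
  ... | tri< lt _ _ = contradiction eq (<⇒≢ (key-mono lt))
  ... | tri> _ _ gt = contradiction (≡-sym eq) (<⇒≢ (key-mono gt))
  ... | tri≈ _ te _ = Fin.toℕ-injective (+-cancelˡ-≡ (t x * m) _ _
          (trans eq (cong (λ k → k * m + toℕ y) (≡-sym te))))
  below : Fin m → Fin m → Bool
  below x z = ⌊ key z <? key x ⌋
  rank< : ∀ x → ∥ below x ∥ < m
  rank< x = <-≤-trans
    (∥∥-strict (λ _ → true) (below x) (λ _ _ → refl) x refl (⌊⌋-false (key x <? key x) (<-irrefl refl)))
    (∣p∣≤n (tabulate (λ _ → true)))
  rank : Fin m → Fin m
  rank x = fromℕ< (rank< x)
  toℕ-rank : ∀ x → toℕ (rank x) ≡ ∥ below x ∥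
  toℕ-rank x = Fin.toℕ-fromℕ< (rank< x)
  rank-mono : ∀ {x y} → key x < key y → ∥ below x ∥ < ∥ below y ∥
  rank-mono {x} {y} lt = ∥∥-strict (below y) (below x)
    (λ z z<x → ⌊⌋-true (key z <? key y) (<-trans (⌊⌋-true⁻¹ (key z <? key x) z<x) lt))
    x (⌊⌋-true (key x <? key y) lt) (⌊⌋-false (key x <? key x) (<-irrefl refl))
  rank⇒key : ∀ x y → toℕ (rank x) ≤ toℕ (rank y) → key x ≤ key y
  rank⇒key x y le rewrite toℕ-rank x | toℕ-rank y = ≮⇒≥ (λ lt → <⇒≱ (rank-mono lt) le)
  rank-inj : Injective _≡_ _≡_ rank
  rank-inj {x} {y} eq = key-inj (≤-antisym (rank⇒key x y (≤-reflexive (cong toℕ eq)))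
                                           (rank⇒key y x (≤-reflexive (cong toℕ (≡-sym eq)))))
  surj : ∀ y → ∃ λ x → rank x ≡ y
  surj = injective⇒surjective rank rank-inj

-- Residues and counting with lists.

%-injective : ∀ p .{{_ : NonZero p}} {i j} → i < j + p → j < i + p → i % p ≡ j % p → i ≡ j
%-injective p {i} {j} i<j+p j<i+p eq = ≤-antisym (half i<j+p eq) (half j<i+p (≡-sym eq))
  where
  half : ∀ {i j} → i < j + p → i % p ≡ j % p → i ≤ j
  half {i} {j} lt eq = begin
    i                     ≡⟨ m≡m%n+[m/n]*n i p ⟩
    i % p + i / p * p     ≤⟨ +-mono-≤ (≤-reflexive eq) (*-monoˡ-≤ p q≤) ⟩
    j % p + j / p * p     ≡⟨ ≡-sym (m≡m%n+[m/n]*n j p) ⟩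
    j                     ∎
    where
    open ≤-Reasoning
    open Data.Nat.DivMod using (_/_)
    lt′ : i / p * p < suc (j / p) * p
    lt′ = +-cancelˡ-< (j % p) _ _ (begin-strict
      j % p + i / p * p         ≡⟨ cong (_+ i / p * p) (≡-sym eq) ⟩
      i % p + i / p * p         ≡⟨ ≡-sym (m≡m%n+[m/n]*n i p) ⟩
      i                         <⟨ lt ⟩
      j + p                     ≡⟨ cong (_+ p) (m≡m%n+[m/n]*n j p) ⟩
      j % p + j / p * p + p     ≡⟨ +-assoc (j % p) _ p ⟩
      j % p + (j / p * p + p)   ≡⟨ cong (j % p +_) (+-comm _ p) ⟩
      j % p + suc (j / p) * p   ∎)
    q≤ : i / p ≤ j / p
    q≤ = s≤s⁻¹ (*-cancelʳ-< p _ _ lt′)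

-- Pigeonhole on positions in the list, so that repeated entries need no treatment.
index-bound : ∀ {A : Set} {s} (xs : List A) (c : Fin s → A) → Injective _≡_ _≡_ c →
              (∀ i → c i ∈ xs) → s ≤ length xs
index-bound {A} xs c c-inj mem = Fin.injective⇒≤ {f = λ i → index (mem i)}
  (λ {i} {j} eq → c-inj (index-injective (setoid A) (mem i) (mem j) eq))

length-concatMap : ∀ {A B : Set} (f : A → List B) xs →
                   length (concatMap f xs) ≡ sum (map (length ∘ f) xs)
length-concatMap f [] = refl
length-concatMap f (x ∷ xs) = trans (length-++ (f x)) (cong (length (f x) +_) (length-concatMap f xs))

sum-map-* : ∀ {A : Set} (f : A → ℕ) c xs → sum (map (λ x → f x * c) xs) ≡ sum (map f xs) * c
sum-map-* f c [] = refl
sum-map-* f c (x ∷ xs) =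
  trans (cong (f x * c +_) (sum-map-* f c xs)) (≡-sym (*-distribʳ-+ c (f x) (sum (map f xs))))

-- Walks and components.

module Walks (G : Graph) where

  V : Set
  V = Fin (n G)

  Adj-sym : ∀ {x y} → Adj G x y → Adj G y x
  Adj-sym {x} {y} = trans (sym G y x)

  module _ {P : V → Set} where

    walk-start : ∀ {x y} → WalkIn G P x y → P x
    walk-start (stay p) = p
    walk-start (step p _ _) = p

    walk-trans : ∀ {x y z} → WalkIn G P x y → WalkIn G P y z → WalkIn G P x z
    walk-trans (stay _) w′ = w′
    walk-trans (step p a w) w′ = step p a (walk-trans w w′)

    walk-sym : ∀ {x y} → WalkIn G P x y → WalkIn G P y x
    walk-sym (stay p) = stay p
    walk-sym (step p a w) = walk-trans (walk-sym w) (step (walk-start w) (Adj-sym a) (stay p))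

  walk-map : ∀ {P Q : V → Set} → (∀ z → P z → Q z) → ∀ {x y} → WalkIn G P x y → WalkIn G Q x y
  walk-map f (stay p) = stay (f _ p)
  walk-map f (step p a w) = step (f _ p) a (walk-map f w)

  -- The last vertex of the walk need not satisfy P.
  data Out (P : V → Set) : ℕ → V → V → Set where
    done : ∀ {u} → Out P zero u u
    hop  : ∀ {m x y u} → P x → Adj G x y → Out P m y u → Out P (suc m) x u

  out-map : ∀ {P Q : V → Set} → (∀ z → P z → Q z) → ∀ {m x u} → Out P m x u → Out Q m x u
  out-map f done = done
  out-map f (hop p a w) = hop (f _ p) a (out-map f w)

  out? : ∀ {P : V → Set} → (∀ z → Dec (P z)) → ∀ m x u → Dec (Out P m x u)
  out? P? zero x u = map′ (λ { refl → done }) (λ { done → refl }) (x Fin.≟ u)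
  out? P? (suc m) x u = map′
    (λ { (p , y , a , w) → hop p a w }) (λ { (hop p a w) → p , _ , a , w })
    (P? x ×-dec Fin.any? (λ y → (adj G x y Bool.≟ true) ×-dec out? P? m y u))

  module _ {P : V → Set} where

    out-start : ∀ {m x u} → Out P m x u → P u → P x
    out-start done p = p
    out-start (hop p _ _) _ = p

    out-trans : ∀ {a b x y z} → Out P a x y → Out P b y z → Out P (a + b) x z
    out-trans done w′ = w′
    out-trans (hop p a w) w′ = hop p a (out-trans w w′)

    out-snoc : ∀ {m x y z} → Out P m x y → P y → Adj G y z → Out P (suc m) x z
    out-snoc done p a = hop p a done
    out-snoc (hop p a w) p′ a′ = hop p a (out-snoc w p′ a′)

    out-unsnoc : ∀ {m x u} → Out P (suc m) x u → ∃ λ z → P z × Adj G z u × Out P m x z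
    out-unsnoc {m = zero} (hop p a done) = _ , p , a , done
    out-unsnoc {m = suc m} (hop p a w) with out-unsnoc w
    ... | z , pz , az , w′ = z , pz , az , hop p a w′

    out-reverse : ∀ {m x u} → Out P m x u → P u → Out P m u x
    out-reverse done p = done
    out-reverse (hop p a w) pu = out-snoc (out-reverse w pu) (out-start w pu) (Adj-sym a)

    walk⇒out : ∀ {x y} → WalkIn G P x y → ∃ λ m → Out P m x y
    walk⇒out (stay _) = zero , done
    walk⇒out (step p a w) with walk⇒out w
    ... | m , o = suc m , hop p a o

    nth : ∀ {m x u} → Out P m x u → ℕ → V
    -- Indices past the end return the last vertex, which keeps `nth` total.
    nth {u = u} done _ = u
    nth {x = x} (hop _ _ _) zero = x
    nth (hop _ _ w) (suc i) = nth w i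

    nth-first : ∀ {m x u} (w : Out P m x u) → nth w zero ≡ x
    nth-first done = refl
    nth-first (hop _ _ _) = refl

    nth-last : ∀ {m x u} (w : Out P m x u) → nth w m ≡ u
    nth-last done = refl
    nth-last (hop _ _ w) = nth-last w

    nth-in : ∀ {m x u} (w : Out P m x u) {i} → i < m → P (nth w i)
    nth-in (hop p _ _) {zero} _ = p
    nth-in (hop _ _ w) {suc i} (s≤s i<m) = nth-in w i<m

    nth-adj : ∀ {m x u} (w : Out P m x u) {i} → i < m → Adj G (nth w i) (nth w (suc i))
    nth-adj (hop _ a w) {zero} _ = subst (Adj G _) (≡-sym (nth-first w)) a
    nth-adj (hop _ _ w) {suc i} (s≤s i<m) = nth-adj w i<m

    nth-prefix : ∀ {m x u} (w : Out P m x u) {i} → i ≤ m → Out P i x (nth w i)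
    nth-prefix w {zero} _ = subst (Out P zero _) (≡-sym (nth-first w)) done
    nth-prefix (hop p a w) {suc i} (s≤s i≤m) = hop p a (nth-prefix w i≤m)

    nth-suffix : ∀ {m x u} (w : Out P m x u) {i} → i ≤ m → Out P (m ∸ i) (nth w i) u
    nth-suffix w {zero} _ = subst (λ z → Out P _ z _) (≡-sym (nth-first w)) w
    nth-suffix (hop _ _ w) {suc i} (s≤s i≤m) = nth-suffix w i≤m

  record Component (U C : V → Bool) : Set where
    field
      inside    : ∀ x → C x ≡ true → U x ≡ true
      closed    : ∀ x z → C x ≡ true → U z ≡ true → Adj G x z → C z ≡ true
      connected : ∀ x y → C x ≡ true → C y ≡ true → WalkIn G (λ z → C z ≡ true) x y

  -- A walk inside `U` can leave a component only by its last step, whose endpoint is exempt from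
  -- `P`; hence the separate clause for a single hop.
  out-closed : ∀ {U C : V → Bool} {P : V → Set} → Component U C → (∀ z → P z → U z ≡ true) →
               ∀ {m x u} → C x ≡ true → Out P m x u → Out (λ z → C z ≡ true) m x u
  out-closed K sub cx done = done
  out-closed K sub cx (hop p a done) = hop cx a done
  out-closed K sub cx (hop p a w@(hop p′ _ _)) =
    hop cx a (out-closed K sub (Component.closed K _ _ cx (sub _ p′) a) w)

  walk-closed : ∀ {U C : V → Bool} → Component U C →
                ∀ {x y} → C x ≡ true → WalkIn G (λ z → U z ≡ true) x y → C y ≡ true
  walk-closed K cx (stay _) = cx
  walk-closed K cx (step _ a w) =
    walk-closed K (Component.closed K _ _ cx (walk-start w) a) w

  private
    module Grow (U : V → Bool) where

      -- Vertices of `U` adjacent to `X` are added one at a time, each with a walk to `y`. The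
      -- number of vertices of `U` outside `X` drops, and a set that cannot grow is closed.
      grow : ∀ m (X : V → Bool) y → X y ≡ true →
             (∀ x → X x ≡ true → U x ≡ true) →
             (∀ x → X x ≡ true → WalkIn G (λ z → X z ≡ true) x y) →
             ∥ (λ z → U z ∧ not (X z)) ∥ < m →
             ∃ λ C → C y ≡ true × Component U C
      grow (suc m) X y Xy X⊆U conn (s≤s size)
        with Fin.any? (λ x → Fin.any? (λ z → (X x Bool.≟ true) ×-dec (adj G x z Bool.≟ true)
               ×-dec (U z Bool.≟ true) ×-dec (X z Bool.≟ false)))
      ... | no stuck = X , Xy , record
        { inside = X⊆U
        ; closed = λ x z Xx Uz a → Bool.¬-not (λ e → stuck (x , z , Xx , a , Uz , e))
        ; connected = λ x z Xx Xz → walk-trans (conn x Xx) (walk-sym (conn z Xz)) }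
      ... | yes (x , z , Xx , a , Uz , ¬Xz) =
        grow m X′ y (keep Xy) X′⊆U conn′ (<-≤-trans shrink size)
        where
        X′ : V → Bool
        X′ w = ⌊ w Fin.≟ z ⌋ ∨ X w
        keep : ∀ {w} → X w ≡ true → X′ w ≡ true
        keep {w} e rewrite e = Bool.∨-zeroʳ _
        new : X′ z ≡ true
        new rewrite ⌊⌋-true (z Fin.≟ z) refl = refl
        X′-inv : ∀ w → X′ w ≡ true → w ≡ z ⊎ X w ≡ true
        X′-inv w e with w Fin.≟ z
        ... | yes eq = inj₁ eq
        ... | no _ = inj₂ e
        X′⊆U : ∀ w → X′ w ≡ true → U w ≡ true
        X′⊆U w e with X′-inv w e
        ... | inj₁ refl = Uz
        ... | inj₂ e′ = X⊆U w e′
        conn′ : ∀ w → X′ w ≡ true → WalkIn G (λ z → X′ z ≡ true) w y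
        conn′ w e with X′-inv w e
        ... | inj₁ refl = step new (Adj-sym a) (walk-map (λ _ → keep) (conn x Xx))
        ... | inj₂ e′ = walk-map (λ _ → keep) (conn w e′)
        shrink : ∥ (λ w → U w ∧ not (X′ w)) ∥ < ∥ (λ w → U w ∧ not (X w)) ∥
        shrink = ∥∥-strict _ _ sub z (cong₂ (λ a b → a ∧ not b) Uz ¬Xz)
                   (trans (cong (λ b → U z ∧ not b) new) (Bool.∧-zeroʳ (U z)))
          where
          sub : ∀ w → U w ∧ not (X′ w) ≡ true → U w ∧ not (X w) ≡ true
          sub w e with X w in eq
          ... | false = trans (Bool.∧-identityʳ (U w)) (proj₁ (∧-true e))
          ... | true = contradiction (trans (≡-sym (proj₂ (∧-true {U w} e)))
                         (cong not (Bool.∨-zeroʳ ⌊ w Fin.≟ z ⌋))) (λ ())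

  component : ∀ U y → U y ≡ true → ∃ λ C → C y ≡ true × Component U C
  component U y Uy = Grow.grow U _ (λ z → ⌊ z Fin.≟ y ⌋) y (⌊⌋-true (y Fin.≟ y) refl)
    (λ x e → subst (λ z → U z ≡ true) (≡-sym (⌊⌋-true⁻¹ (x Fin.≟ y) e)) Uy)
    (λ x e → subst (WalkIn G _ x) (⌊⌋-true⁻¹ (x Fin.≟ y) e) (stay e))
    ≤-refl

-- Models of parts of H - v and their attachment to a component.

module Models (H : Graph) (v : Fin (n H)) (G : Graph) where

  open Walks G

  W E : Set
  W = Fin (n H)
  E = W × W

  _≟ᴱ_ : DecidableEquality E
  _≟ᴱ_ = ≡-dec Fin._≟_ Fin._≟_

  module UpdV = Update {V} Fin._≟_
  module UpdW = Update {W} Fin._≟_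
  module UpdE = Update {E} _≟ᴱ_

  -- The summand of `edgesMinus`: an edge of H - v is listed once, with its smaller end first.
  isEdge : E → Bool
  isEdge (i , j) = (i <ᵇF j) ∧ adj H i j ∧ (i ≠ᵇ v) ∧ (j ≠ᵇ v)

  isIsolated : W → Bool
  isIsolated u = (u ≠ᵇ v) ∧ all (λ w → not (adj H u w) ∨ not (w ≠ᵇ v)) (allFin (n H))

  ≠ᵇ⇒≢ : ∀ {i j : W} → (i ≠ᵇ j) ≡ true → i ≢ j
  ≠ᵇ⇒≢ {i} {j} eq with i Fin.≟ j
  ... | no ne = ne

  ≢⇒≠ᵇ : ∀ {i j : W} → i ≢ j → (i ≠ᵇ j) ≡ true
  ≢⇒≠ᵇ {i} {j} ne = cong not (⌊⌋-false (i Fin.≟ j) ne)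

  isEdge⇒≢ : ∀ e → isEdge e ≡ true → proj₁ e ≢ v × proj₂ e ≢ v
  isEdge⇒≢ (i , j) eq with ∧-true {i <ᵇF j} eq
  ... | _ , eq₁ with ∧-true {adj H i j} eq₁
  ...   | _ , eq₂ with ∧-true {i ≠ᵇ v} eq₂
  ...     | p , q = ≠ᵇ⇒≢ p , ≠ᵇ⇒≢ q

  <⇒isEdge : ∀ {i j} → toℕ i < toℕ j → Adj H i j → i ≢ v → j ≢ v → isEdge (i , j) ≡ true
  <⇒isEdge {i} {j} lt a i≢v j≢v
    rewrite Equivalence.to Bool.T-≡ (<⇒<ᵇ lt) | a | ≢⇒≠ᵇ i≢v | ≢⇒≠ᵇ j≢v = refl

  adj⇒isEdge : ∀ {i j} → Adj H i j → i ≢ v → j ≢ v → isEdge (i , j) ≡ true ⊎ isEdge (j , i) ≡ true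
  adj⇒isEdge {i} {j} a i≢v j≢v with <-cmp (toℕ i) (toℕ j)
  ... | tri< lt _ _ = inj₁ (<⇒isEdge lt a i≢v j≢v)
  ... | tri> _ _ gt = inj₂ (<⇒isEdge gt (trans (sym H j i) a) j≢v i≢v)
  ... | tri≈ _ eq _ with Fin.toℕ-injective eq
  ...   | refl = contradiction (irrefl H i) (true≢false a)

  At : W → E → Set
  At k e = proj₁ e ≡ k ⊎ proj₂ e ≡ k

  at? : ∀ k e → Dec (At k e)
  at? k e = (proj₁ e Fin.≟ k) ⊎-dec (proj₂ e Fin.≟ k)

  isolated-or-edge : ∀ k → k ≢ v → isIsolated k ≡ true ⊎ ∃ λ e → isEdge e ≡ true × At k e
  isolated-or-edge k k≢v with all-or-counterexample (λ w → not (adj H k w) ∨ not (w ≠ᵇ v)) (allFin (n H))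
  ... | inj₁ eq rewrite ≢⇒≠ᵇ k≢v = inj₁ eq
  ... | inj₂ (w , eq) with adj H k w in a | w Fin.≟ v
  ...   | true | no w≢v with adj⇒isEdge a k≢v w≢v
  ...     | inj₁ e = inj₂ ((k , w) , e , inj₁ refl)
  ...     | inj₂ e = inj₂ ((w , k) , e , inj₂ refl)

  -- The vertices of G outside the current component are labelled: core k is the part of G
  -- committed to the branch set of k, while the vertices labelled rest (i , j) connect
  -- core i to core j and may still be given to either side.
  data Lab : Set where
    none : Lab
    core : W → Lab
    rest : E → Lab

  rest-injective : ∀ {e f} → rest e ≡ rest f → e ≡ f
  rest-injective refl = refl

  -- A path at 0, …, at len, of which the indices strictly between lo and hi are
  -- the ones not yet absorbed by the cores of the two ends.
  record Track : Set where
    field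
      at        : ℕ → V
      len lo hi : ℕ
  open Track

  -- Absorbing track vertices only narrows the window; `at` and `len` never change, so the isometry
  -- of the whole path stays available for counting.
  window : Track → ℕ → ℕ → Track
  window t lo′ hi′ = record t { lo = lo′ ; hi = hi′ }

  Inner : Track → V → Set
  Inner t x = ∃ λ i → lo t < i × i < hi t × at t i ≡ x

  -- Each vertex has a single label, so cores and the open parts of different tracks are disjoint
  -- automatically; `distinct` excludes repetition within one track.
  record Valid (lab : V → Lab) (e : E) (t : Track) : Set where
    field
      lo<hi    : lo t < hi t
      hi≤len   : hi t ≤ len t
      lo-core  : lab (at t (lo t)) ≡ core (proj₁ e)
      hi-core  : lab (at t (hi t)) ≡ core (proj₂ e)
      inner    : ∀ {i} → lo t < i → i < hi t → lab (at t i) ≡ rest e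
      linked   : ∀ {i} → lo t ≤ i → i < hi t → Adj G (at t i) (at t (suc i))
      distinct : ∀ {i j} → lo t < i → i < hi t → lo t < j → j < hi t → at t i ≡ at t j → i ≡ j

  valid-map : ∀ {lab lab′ e t} →
    (∀ {k x} → At k e → lab x ≡ core k → lab′ x ≡ core k) →
    (∀ {x} → lab x ≡ rest e → lab′ x ≡ rest e) →
    Valid lab e t → Valid lab′ e t
  valid-map keep-core keep-rest Vt = record
    { lo<hi = lo<hi ; hi≤len = hi≤len
    ; lo-core = keep-core (inj₁ refl) lo-core
    ; hi-core = keep-core (inj₂ refl) hi-core
    ; inner = λ p q → keep-rest (inner p q)
    ; linked = linked ; distinct = distinct }
    where open Valid Vt

  -- A core is kept connected by walks from its vertices to a root. No core belongs to `v`, whose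
  -- branch set is reserved for the final component.
  record Model : Set where
    field
      root : W → Maybe V
      tr   : E → Maybe Track
      lab  : V → Lab
      root-v      : root v ≡ nothing
      core-rooted : ∀ {x k} → lab x ≡ core k →
                    ∃ λ ρ → root k ≡ just ρ × WalkIn G (λ z → lab z ≡ core k) x ρ
      tr-edge     : ∀ {e t} → tr e ≡ just t → isEdge e ≡ true
      tr-valid    : ∀ {e t} → tr e ≡ just t → Valid lab e t
      rest-tr     : ∀ {x e} → lab x ≡ rest e → ∃ λ t → tr e ≡ just t × Inner t x

    ends-rooted : ∀ {e t k} → tr e ≡ just t → At k e → ∃ λ ρ → root k ≡ just ρ
    ends-rooted eq (inj₁ refl) with core-rooted (Valid.lo-core (tr-valid eq))
    ... | ρ , r , _ = ρ , r
    ends-rooted eq (inj₂ refl) with core-rooted (Valid.hi-core (tr-valid eq))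
    ... | ρ , r , _ = ρ , r

  just≢nothing : ∀ {A : Set} {m : Maybe A} {a} → m ≡ just a → m ≢ nothing
  just≢nothing refl ()

  infixl 6 _∖_
  _∖_ : (V → Bool) → (V → Bool) → V → Bool
  (C ∖ P) x = C x ∧ not (P x)

  ∖-true : ∀ {C P : V → Bool} {x} → (C ∖ P) x ≡ true → C x ≡ true × P x ≡ false
  ∖-true {C} {P} {x} eq with C x | P x
  ... | true | false = refl , refl

  ∖-intro : ∀ {C P : V → Bool} {x} → C x ≡ true → P x ≡ false → (C ∖ P) x ≡ true
  ∖-intro c p rewrite c | p = refl

  ∖-out : ∀ {C P : V → Bool} {x} → P x ≡ true → (C ∖ P) x ≡ false
  ∖-out {C} {P} {x} p rewrite p = Bool.∧-zeroʳ (C x)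

  ∖-false : ∀ {C P : V → Bool} {x} → (C ∖ P) x ≡ false → P x ≡ false → C x ≡ false
  ∖-false {C} {P} {x} d p =
    trans (≡-sym (trans (cong (λ b → C x ∧ not b) p) (Bool.∧-identityʳ (C x)))) d

  OutIn : (V → Bool) → ℕ → V → V → Set
  OutIn C = Out (λ z → C z ≡ true)

  Touch : (V → Bool) → V → Set
  Touch C x = ∃ λ z → C z ≡ true × Adj G z x

  touch? : ∀ C x → Dec (Touch C x)
  touch? C x = Fin.any? (λ z → (C z Bool.≟ true) ×-dec (adj G z x Bool.≟ true))

  -- Exchanging the two indices bounds their distance by the total length `a + b` of two walks from
  -- a common vertex `y`. The walks run through `C`, so the property passes to subsets of `C`.
  Isometric : (V → Bool) → (ℕ → V) → ℕ → Set
  Isometric C f ℓ = ∀ {y a b i j} → C y ≡ true → i ≤ ℓ → j ≤ ℓ →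
                    OutIn C a y (f i) → OutIn C b y (f j) → j ≤ i + (a + b)

  Near : (V → Bool) → V → Set
  Near C x = C x ≡ true ⊎ Touch C x

  -- The three sources of a slot for `q k`. The index `i` ranges over the whole path, absorbed ends
  -- included, because `q k` may have moved along the track.
  Covered Missing Cover : (E → Maybe Track) → (W → V) → W → Set
  Covered tr q k = ∃ λ e → ∃ λ t → ∃ λ i → tr e ≡ just t × At k e × i ≤ len t × at t i ≡ q k
  Missing tr q k = ∃ λ e → isEdge e ≡ true × tr e ≡ nothing × At k e
  Cover tr q k = isIsolated k ≡ true ⊎ Missing tr q k ⊎ Covered tr q k

  -- D is the part of C left unplaced. For D = C the field boundary says that q k is the only
  -- vertex of core k that may have a neighbour in C.
  record Attached (M : Model) (q : W → V) (C D : V → Bool) : Set where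
    open Model M
    field
      q-core   : ∀ {k ρ} → root k ≡ just ρ → lab (q k) ≡ core k
      fresh    : ∀ {x} → D x ≡ true → lab x ≡ none
      boundary : ∀ {x} → Near C x → D x ≡ false →
                 (∃ λ k → lab x ≡ core k × x ≡ q k) ⊎ (∃ λ e → lab x ≡ rest e)
      iso      : ∀ {e t} → tr e ≡ just t → Isometric C (at t) (len t)
      cover    : ∀ {k ρ} → root k ≡ just ρ → Cover tr q k

  AllTouch : Model → (W → V) → (V → Bool) → Set
  AllTouch M q C = ∀ {k ρ} → Model.root M k ≡ just ρ → Touch C (q k)

  record State (C : V → Bool) : Set where
    field
      M        : Model
      q        : W → V
      attached : Attached M q C C
      touches  : AllTouch M q C

  -- Placing a new core vertex

  module AddVertex {M q C} (A : Attached M q C C) {k : W} (k≢v : k ≢ v)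
                   (unrooted : Model.root M k ≡ nothing) {y : V} (Cy : C y ≡ true) where
    open Model M
    open Attached A

    P : V → Bool
    P x = ⌊ x Fin.≟ y ⌋

    lab′ : V → Lab
    lab′ = UpdV.upd y (core k) lab

    -- The relabelled vertex lies in `C` and was unlabelled, so earlier labels persist.
    lab-keep : ∀ {x l} → lab x ≡ l → l ≢ none → lab′ x ≡ l
    lab-keep eq l≢none = trans (UpdV.upd-other y (core k) lab
      (λ { refl → l≢none (trans (≡-sym eq) (fresh Cy)) })) eq

    k≢rooted : ∀ {k′ ρ} → root k′ ≡ just ρ → k′ ≢ k
    k≢rooted r refl = just≢nothing r unrooted

    M′ : Model
    M′ = record
      { root = UpdW.upd k (just y) root
      ; tr = tr
      ; lab = lab′
      ; root-v = trans (UpdW.upd-other k (just y) root (k≢v ∘ ≡-sym)) root-v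
      ; core-rooted = rooted
      ; tr-edge = tr-edge
      ; tr-valid = λ eq → valid-map (λ _ c → lab-keep c λ ()) (λ c → lab-keep c λ ()) (tr-valid eq)
      ; rest-tr = rest-tr′ }
      where
      rooted : ∀ {x k′} → lab′ x ≡ core k′ → ∃ λ ρ → UpdW.upd k (just y) root k′ ≡ just ρ ×
               WalkIn G (λ z → lab′ z ≡ core k′) x ρ
      rooted {x} eq with UpdV.upd-inv y (core k) lab x eq
      ... | inj₁ (refl , refl) = y , UpdW.upd-same k (just y) root , stay eq
      ... | inj₂ (_ , old) with core-rooted old
      ...   | ρ , r , w = ρ , trans (UpdW.upd-other k (just y) root (k≢rooted r)) r
                        , walk-map (λ _ c → lab-keep c λ ()) w
      rest-tr′ : ∀ {x e} → lab′ x ≡ rest e → ∃ λ t → tr e ≡ just t × Inner t x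
      rest-tr′ {x} eq with UpdV.upd-inv y (core k) lab x eq
      ... | inj₂ (_ , old) = rest-tr old

    q′ : W → V
    q′ = UpdW.upd k y q

    A′ : Attached M′ q′ C (C ∖ P)
    A′ = record
      { q-core = q-core′ ; fresh = fresh′ ; boundary = boundary′ ; iso = iso ; cover = cover′ }
      where
      q-core′ : ∀ {k′ ρ} → Model.root M′ k′ ≡ just ρ → lab′ (q′ k′) ≡ core k′
      q-core′ {k′} eq with UpdW.upd-inv k (just y) root k′ eq
      ... | inj₁ (refl , _) = trans (cong lab′ (UpdW.upd-same k y q)) (UpdV.upd-same y (core k) lab)
      ... | inj₂ (k′≢k , old) = trans (cong lab′ (UpdW.upd-other k y q k′≢k))
                                      (lab-keep (q-core old) λ ())
      fresh′ : ∀ {x} → (C ∖ P) x ≡ true → lab′ x ≡ none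
      fresh′ {x} d with ∖-true {C} {P} d
      ... | c , p = trans (override-out P (core k) lab p) (fresh c)
      boundary′ : ∀ {x} → Near C x → (C ∖ P) x ≡ false →
                  (∃ λ k → lab′ x ≡ core k × x ≡ q′ k) ⊎ (∃ λ e → lab′ x ≡ rest e)
      boundary′ {x} near d = split (x Fin.≟ y)
        where
        split : Dec (x ≡ y) → (∃ λ k → lab′ x ≡ core k × x ≡ q′ k) ⊎ (∃ λ e → lab′ x ≡ rest e)
        split (yes refl) = inj₁ (k , UpdV.upd-same y (core k) lab , ≡-sym (UpdW.upd-same k y q))
        split (no x≢y) with boundary near (∖-false {C} {P} d (⌊⌋-false (x Fin.≟ y) x≢y))
        ... | inj₂ (e , c) = inj₂ (e , lab-keep c λ ())
        ... | inj₁ (k′ , c , refl) = inj₁ (k′ , lab-keep c (λ ()) ,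
                ≡-sym (UpdW.upd-other k y q (k≢rooted (proj₁ (proj₂ (core-rooted c))))))
      cover′ : ∀ {k′ ρ} → Model.root M′ k′ ≡ just ρ → Cover tr q′ k′
      cover′ {k′} eq with UpdW.upd-inv k (just y) root k′ eq
      cover′ {k′} eq | inj₁ (refl , _) with isolated-or-edge k k≢v
      ... | inj₁ i = inj₁ i
      ... | inj₂ (e , isE , at-k) = inj₂ (inj₁ (e , isE , no-track , at-k))
        where
        -- A track at `k` would force `k` to have a root already.
        no-track : tr e ≡ nothing
        no-track with tr e in eq
        ... | nothing = refl
        ... | just t = contradiction unrooted (just≢nothing (proj₂ (ends-rooted eq at-k)))
      cover′ {k′} eq | inj₂ (k′≢k , old) with cover old
      ... | inj₁ i = inj₁ i
      ... | inj₂ (inj₁ m) = inj₂ (inj₁ m)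
      ... | inj₂ (inj₂ (e , t , i , eq , a , le , at≡)) =
              inj₂ (inj₂ (e , t , i , eq , a , le , trans at≡ (≡-sym (UpdW.upd-other k y q k′≢k))))

  -- Placing a new track

  record Route (C : V → Bool) (s u : V) : Set where
    field
      pt     : ℕ → V
      ℓ      : ℕ
      1<ℓ    : 1 < ℓ
      start  : pt 0 ≡ s
      end    : pt ℓ ≡ u
      inside : ∀ {i} → 0 < i → i < ℓ → C (pt i) ≡ true
      steps  : ∀ {i} → i < ℓ → Adj G (pt i) (pt (suc i))
      isom   : Isometric C pt ℓ

  -- A shortest walk from s to u through C; if two of its vertices could be reached from
  -- y ∈ C by shorter walks, rerouting through y would shorten it.
  route : ∀ {C s u} → (∀ x y → C x ≡ true → C y ≡ true → WalkIn G (λ z → C z ≡ true) x y) →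
          C s ≡ false → C u ≡ false → Touch C s → Touch C u → Route C s u
  route {C} {s} {u} conn s∉C u∉C (x₀ , Cx₀ , ax₀) (z₀ , Cz₀ , az₀) = build (least Q? _ found)
    where
    Q : ℕ → Set
    -- The edge leaving `s` is not counted in `m`: the whole walk has length `m + 1`.
    Q m = ∃ λ x → Adj G s x × C x ≡ true × OutIn C m x u
    Q? : ∀ m → Dec (Q m)
    Q? m = Fin.any? (λ x → (adj G s x Bool.≟ true) ×-dec (C x Bool.≟ true)
                           ×-dec out? (λ z → C z Bool.≟ true) m x u)
    found : Q (suc (proj₁ (walk⇒out (conn x₀ z₀ Cx₀ Cz₀))))
    found = x₀ , Adj-sym ax₀ , Cx₀ , out-snoc (proj₂ (walk⇒out (conn x₀ z₀ Cx₀ Cz₀))) Cz₀ az₀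
    build : (∃ λ m → Q m × (∀ j → Q j → m ≤ j)) → Route C s u
    build (zero , (x , a , Cx , done) , min) = contradiction u∉C (true≢false Cx)
    build (m@(suc m′) , (x , a , Cx , w) , min) = record
      { pt = pt ; ℓ = suc m ; 1<ℓ = s≤s (s≤s z≤n) ; start = refl ; end = nth-last w
      ; inside = inside ; steps = steps ; isom = isom }
      where
      pt : ℕ → V
      pt zero = s
      pt (suc i) = nth w i
      inside : ∀ {i} → 0 < i → i < suc m → C (pt i) ≡ true
      inside {suc i} _ (s≤s i<m) = nth-in w i<m
      steps : ∀ {i} → i < suc m → Adj G (pt i) (pt (suc i))
      steps {zero} _ = subst (Adj G s) (≡-sym (nth-first w)) a
      steps {suc i} (s≤s i<m) = nth-adj w i<m
      shorten : ∀ {d j} → j ≤ m → m ≤ d + (m ∸ j) → j ≤ d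
      shorten {d} {j} j≤m le = +-cancelʳ-≤ (m ∸ j) j d (≤-trans (≤-reflexive (m+[n∸m]≡n j≤m)) le)
      isom : Isometric C pt (suc m)
      isom {j = zero} _ _ _ _ _ = z≤n
      isom {i = zero} {suc j} Cy _ _ done _ = contradiction s∉C (true≢false Cy)
      -- The walk from `y` to `s` enters `s` from a neighbour `x′` in `C`. Going from `s` through
      -- `x′` and `y` to index `j`, then on along the old walk, competes with the minimum.
      isom {a = suc a} {b} {zero} {suc j} Cy _ (s≤s j≤m) o₁ o₂ with out-unsnoc o₁
      ... | x′ , Cx′ , adj-s , o₁′ = s≤s (shorten j≤m
              (min _ (x′ , Adj-sym adj-s , Cx′ ,
                      out-trans (out-trans (out-reverse o₁′ Cx′) o₂) (nth-suffix w j≤m))))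
      isom {a = a₁} {b} {suc i} {suc j} Cy (s≤s i≤m) (s≤s j≤m) o₁ o₂ with i Data.Nat.≟ m
      -- The first index is that of `u`, the end of the route, and no index exceeds it.
      ... | yes refl = ≤-trans (s≤s j≤m) (m≤m+n _ _)
      ... | no i≢m = s≤s (shorten j≤m (≤-trans
              (min _ (x , a , Cx , out-trans (nth-prefix w i≤m)
                (out-trans (out-trans (out-reverse o₁ (nth-in w (≤∧≢⇒< i≤m i≢m))) o₂) (nth-suffix w j≤m))))
              (≤-reflexive (≡-sym (+-assoc i (a₁ + b) (m ∸ j))))))

  module AddTrack {M q C} (A : Attached M q C C) {e : E} (isE : isEdge e ≡ true)
                  (free : Model.tr M e ≡ nothing)
                  {ρ₁ ρ₂ : V} (root₁ : Model.root M (proj₁ e) ≡ just ρ₁)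
                  (root₂ : Model.root M (proj₂ e) ≡ just ρ₂)
                  (R : Route C (q (proj₁ e)) (q (proj₂ e))) where
    open Model M
    open Attached A
    open Route R

    t₀ : Track
    t₀ = record { at = pt ; len = ℓ ; lo = 0 ; hi = ℓ }

    interior? : ∀ z → Dec (∃ λ (i : Fin ℓ) → 0 < toℕ i × pt (toℕ i) ≡ z)
    interior? z = Fin.any? (λ i → (0 <? toℕ i) ×-dec (pt (toℕ i) Fin.≟ z))

    P : V → Bool
    P z = ⌊ interior? z ⌋

    P-inner : ∀ {z} → P z ≡ true → Inner t₀ z
    P-inner {z} p with ⌊⌋-true⁻¹ (interior? z) p
    ... | i , pos , eq = toℕ i , pos , Fin.toℕ<n i , eq

    inner-P : ∀ {i} → 0 < i → i < ℓ → P (pt i) ≡ true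
    inner-P {i} pos lt = ⌊⌋-true (interior? (pt i))
      (fromℕ< lt , subst (0 <_) (≡-sym (Fin.toℕ-fromℕ< lt)) pos , cong pt (Fin.toℕ-fromℕ< lt))

    P⊆C : ∀ {z} → P z ≡ true → C z ≡ true
    P⊆C p with P-inner p
    ... | i , pos , lt , refl = inside pos lt

    lab′ : V → Lab
    lab′ = override P (rest e) lab

    lab-keep : ∀ {x l} → lab x ≡ l → l ≢ none → lab′ x ≡ l
    lab-keep eq l≢none = trans (override-out P (rest e) lab
      (≢true⇒≡false (λ p → l≢none (trans (≡-sym eq) (fresh (P⊆C p)))))) eq

    tr′ : E → Maybe Track
    tr′ = UpdE.upd e (just t₀) tr

    tr-keep : ∀ {f t} → tr f ≡ just t → tr′ f ≡ just t
    tr-keep eq = trans (UpdE.upd-other e (just t₀) tr (λ { refl → just≢nothing eq free })) eq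

    M′ : Model
    M′ = record
      { root = root ; tr = tr′ ; lab = lab′ ; root-v = root-v
      ; core-rooted = rooted ; tr-edge = edge ; tr-valid = valid ; rest-tr = rest-tr′ }
      where
      rooted : ∀ {x k} → lab′ x ≡ core k → ∃ λ ρ → root k ≡ just ρ ×
               WalkIn G (λ z → lab′ z ≡ core k) x ρ
      rooted {x} eq with override-inv P (rest e) lab x eq
      ... | inj₂ (_ , old) with core-rooted old
      ...   | ρ , r , w = ρ , r , walk-map (λ _ c → lab-keep c λ ()) w
      edge : ∀ {f t} → tr′ f ≡ just t → isEdge f ≡ true
      edge {f} eq with UpdE.upd-inv e (just t₀) tr f eq
      ... | inj₁ (refl , _) = isE
      ... | inj₂ (_ , old) = tr-edge old
      valid : ∀ {f t} → tr′ f ≡ just t → Valid lab′ f t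
      valid {f} eq with UpdE.upd-inv e (just t₀) tr f eq
      ... | inj₂ (_ , old) = valid-map (λ _ c → lab-keep c λ ()) (λ c → lab-keep c λ ()) (tr-valid old)
      ... | inj₁ (refl , refl) = record
        { lo<hi = <-trans z<s 1<ℓ
        ; hi≤len = ≤-refl
        ; lo-core = lab-keep (trans (cong lab start) (q-core root₁)) λ ()
        ; hi-core = lab-keep (trans (cong lab end) (q-core root₂)) λ ()
        ; inner = λ pos lt → override-in P (rest e) lab (inner-P pos lt)
        ; linked = λ _ lt → steps lt
        ; distinct = λ p₁ l₁ p₂ l₂ eq → ≤-antisym (bound p₂ l₂ p₁ l₁ (≡-sym eq)) (bound p₁ l₁ p₂ l₂ eq) }
        where
        -- Isometry applied to two walks of length zero at the common vertex.
        bound : ∀ {i j} → 0 < i → i < ℓ → 0 < j → j < ℓ → pt i ≡ pt j → j ≤ i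
        bound {i} {j} p₁ l₁ p₂ l₂ eq = subst (j ≤_) (+-identityʳ i)
          (isom (inside p₁ l₁) (<⇒≤ l₁) (<⇒≤ l₂) done (subst (OutIn C 0 (pt i)) eq done))
      rest-tr′ : ∀ {x f} → lab′ x ≡ rest f → ∃ λ t → tr′ f ≡ just t × Inner t x
      rest-tr′ {x} eq with override-inv P (rest e) lab x eq
      ... | inj₁ (p , refl) = t₀ , UpdE.upd-same e (just t₀) tr , P-inner p
      ... | inj₂ (_ , old) with rest-tr old
      ...   | t , eq′ , inn = t , tr-keep eq′ , inn

    A′ : Attached M′ q C (C ∖ P)
    A′ = record
      { q-core = λ r → lab-keep (q-core r) λ ()
      ; fresh = fresh′ ; boundary = boundary′ ; iso = iso′ ; cover = λ r → cover′ (cover r) }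
      where
      fresh′ : ∀ {x} → (C ∖ P) x ≡ true → lab′ x ≡ none
      fresh′ {x} d with ∖-true {C} {P} d
      ... | c , p = trans (override-out P (rest e) lab p) (fresh c)
      boundary′ : ∀ {x} → Near C x → (C ∖ P) x ≡ false →
                  (∃ λ k → lab′ x ≡ core k × x ≡ q k) ⊎ (∃ λ f → lab′ x ≡ rest f)
      boundary′ {x} near d = split (P x) refl
        where
        split : ∀ b → P x ≡ b → (∃ λ k → lab′ x ≡ core k × x ≡ q k) ⊎ (∃ λ f → lab′ x ≡ rest f)
        split true p = inj₂ (e , override-in P (rest e) lab p)
        split false p with boundary near (∖-false {C} {P} d p)
        ... | inj₁ (k , c , eq) = inj₁ (k , lab-keep c (λ ()) , eq)
        ... | inj₂ (f , c) = inj₂ (f , lab-keep c λ ())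
      iso′ : ∀ {f t} → tr′ f ≡ just t → Isometric C (at t) (len t)
      iso′ {f} eq with UpdE.upd-inv e (just t₀) tr f eq
      ... | inj₁ (refl , refl) = isom
      ... | inj₂ (_ , old) = iso old
      ends-covered : ∀ {k} → At k e → Covered tr′ q k
      ends-covered (inj₁ refl) =
        e , t₀ , 0 , UpdE.upd-same e (just t₀) tr , inj₁ refl , z≤n , start
      ends-covered (inj₂ refl) =
        e , t₀ , ℓ , UpdE.upd-same e (just t₀) tr , inj₂ refl , ≤-refl , end
      cover′ : ∀ {k} → Cover tr q k → Cover tr′ q k
      cover′ (inj₁ i) = inj₁ i
      cover′ (inj₂ (inj₂ (f , t , i , eq , rst))) = inj₂ (inj₂ (f , t , i , tr-keep eq , rst))
      cover′ (inj₂ (inj₁ (f , isF , eq , a))) with f ≟ᴱ e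
      -- The missing edge is the one just given a track, and this track starts or ends at `q k`.
      ... | yes refl = inj₂ (inj₂ (ends-covered a))
      ... | no f≢e = inj₂ (inj₁ (f , isF , trans (UpdE.upd-other e (just t₀) tr f≢e) eq , a))

  -- Restoring the attachment after passing to a smaller component

  record Restored (M : Model) (q : W → V) (C : V → Bool) (k : W) : Set where
    open Model
    field
      M′       : Model
      q′       : W → V
      attached : Attached M′ q′ C C
      touched  : ∀ {ρ} → root M′ k ≡ just ρ → Touch C (q′ k)
      others   : ∀ {l ρ} → l ≢ k → root M′ l ≡ just ρ → root M l ≡ just ρ × q′ l ≡ q l

  -- Of core `k` only `q k` could touch `C`, and it does not; neither does the unabsorbed part of
  -- any track at `k`. Erasing these labels therefore leaves the boundary intact.
  module Drop {M q C} (A : Attached M q C C) (k : W)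
              (q-dead : ¬ Touch C (q k))
              (rest-dead : ∀ {x e} → Model.lab M x ≡ rest e → At k e → ¬ Touch C x) where
    open Model M
    open Attached A

    clean : Lab → Lab
    clean none = none
    clean (core l) = if ⌊ l Fin.≟ k ⌋ then none else core l
    clean (rest e) = if ⌊ at? k e ⌋ then none else rest e

    clean-core : ∀ {l} → l ≢ k → clean (core l) ≡ core l
    clean-core {l} ne rewrite ⌊⌋-false (l Fin.≟ k) ne = refl

    clean-rest : ∀ {e} → ¬ At k e → clean (rest e) ≡ rest e
    clean-rest {e} ne rewrite ⌊⌋-false (at? k e) ne = refl

    clean-core⁻¹ : ∀ l {i} → clean l ≡ core i → l ≡ core i × i ≢ k
    clean-core⁻¹ (core l) eq with l Fin.≟ k
    clean-core⁻¹ (core l) refl | no ne = refl , ne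
    clean-core⁻¹ (rest e) eq with at? k e
    clean-core⁻¹ (rest e) () | yes _
    clean-core⁻¹ (rest e) () | no _

    clean-rest⁻¹ : ∀ l {e} → clean l ≡ rest e → l ≡ rest e × ¬ At k e
    clean-rest⁻¹ (rest e) eq with at? k e
    clean-rest⁻¹ (rest e) refl | no ne = refl , ne
    clean-rest⁻¹ (core l) eq with l Fin.≟ k
    clean-rest⁻¹ (core l) () | yes _
    clean-rest⁻¹ (core l) () | no _

    root′ : W → Maybe V
    root′ = UpdW.upd k nothing root

    root-old : ∀ {l ρ} → root′ l ≡ just ρ → l ≢ k × root l ≡ just ρ
    root-old {l} eq with UpdW.upd-inv k nothing root l eq
    ... | inj₂ r = r

    tr′ : E → Maybe Track
    tr′ = override (λ e → ⌊ at? k e ⌋) nothing tr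

    tr-old : ∀ {e t} → tr′ e ≡ just t → ¬ At k e × tr e ≡ just t
    tr-old {e} eq with override-inv (λ e → ⌊ at? k e ⌋) nothing tr e eq
    ... | inj₂ (na , old) = ⌊⌋-false⁻¹ (at? k e) na , old

    tr-keep : ∀ {e m} → ¬ At k e → tr e ≡ m → tr′ e ≡ m
    tr-keep {e} na eq =
      trans (override-out (λ e → ⌊ at? k e ⌋) nothing tr (⌊⌋-false (at? k e) na)) eq

    tr-dropped : ∀ {e} → At k e → tr′ e ≡ nothing
    tr-dropped {e} a = override-in (λ e → ⌊ at? k e ⌋) nothing tr (⌊⌋-true (at? k e) a)

    core-keep : ∀ {x l} → l ≢ k → lab x ≡ core l → clean (lab x) ≡ core l
    core-keep ne eq = trans (cong clean eq) (clean-core ne)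

    rest-keep : ∀ {x e} → ¬ At k e → lab x ≡ rest e → clean (lab x) ≡ rest e
    rest-keep ne eq = trans (cong clean eq) (clean-rest ne)

    M′ : Model
    M′ = record
      { root = root′ ; tr = tr′ ; lab = clean ∘ lab ; root-v = no-v
      ; core-rooted = rooted
      ; tr-edge = λ eq → tr-edge (proj₂ (tr-old eq))
      ; tr-valid = λ eq → valid-map (λ a → core-keep (λ { refl → proj₁ (tr-old eq) a }))
                                    (rest-keep (proj₁ (tr-old eq)))
                                    (tr-valid (proj₂ (tr-old eq)))
      ; rest-tr = rest-tr′ }
      where
      no-v : root′ v ≡ nothing
      no-v with root′ v in eq
      ... | nothing = refl
      ... | just ρ = contradiction root-v (just≢nothing (proj₂ (root-old eq)))
      rooted : ∀ {x l} → clean (lab x) ≡ core l → ∃ λ ρ → root′ l ≡ just ρ ×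
               WalkIn G (λ z → clean (lab z) ≡ core l) x ρ
      rooted {x} eq with clean-core⁻¹ (lab x) eq
      ... | old , l≢k with core-rooted old
      ...   | ρ , r , w = ρ , trans (UpdW.upd-other k nothing root l≢k) r
                        , walk-map (λ _ → core-keep l≢k) w
      rest-tr′ : ∀ {x e} → clean (lab x) ≡ rest e → ∃ λ t → tr′ e ≡ just t × Inner t x
      rest-tr′ {x} eq with clean-rest⁻¹ (lab x) eq
      ... | old , na with rest-tr old
      ...   | t , eq′ , inn = t , tr-keep na eq′ , inn

    A′ : Attached M′ q C C
    A′ = record
      { q-core = λ r → core-keep (proj₁ (root-old r)) (q-core (proj₂ (root-old r)))
      ; fresh = λ c → cong clean (fresh c)
      ; boundary = boundary′
      ; iso = λ eq → iso (proj₂ (tr-old eq))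
      ; cover = λ r → cover′ (cover (proj₂ (root-old r))) }
      where
      boundary′ : ∀ {x} → Near C x → C x ≡ false →
                  (∃ λ l → clean (lab x) ≡ core l × x ≡ q l) ⊎ (∃ λ e → clean (lab x) ≡ rest e)
      boundary′ (inj₁ Cx) ¬Cx = contradiction ¬Cx (true≢false Cx)
      boundary′ near@(inj₂ touch) ¬Cx with boundary near ¬Cx
      ... | inj₁ (l , c , refl) = inj₁ (l , core-keep (λ { refl → q-dead touch }) c , refl)
      ... | inj₂ (e , c) = inj₂ (e , rest-keep (λ a → rest-dead c a touch) c)
      cover′ : ∀ {l} → Cover tr q l → Cover tr′ q l
      cover′ (inj₁ i) = inj₁ i
      cover′ (inj₂ (inj₁ (e , isE , eq , a))) with at? k e
      ... | yes at-k = inj₂ (inj₁ (e , isE , tr-dropped at-k , a))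
      ... | no na = inj₂ (inj₁ (e , isE , tr-keep na eq , a))
      cover′ (inj₂ (inj₂ (e , t , i , eq , a , rst))) with at? k e
      -- Losing the covering track makes its edge missing, which still yields a slot for `q l`.
      ... | yes at-k = inj₂ (inj₁ (e , tr-edge eq , tr-dropped at-k , a))
      ... | no na = inj₂ (inj₂ (e , t , i , tr-keep na eq , a , rst))

    restored : Restored M q C k
    restored = record
      { M′ = M′ ; q′ = q ; attached = A′
      ; touched = λ r → contradiction refl (proj₁ (root-old r))
      ; others = λ _ r → proj₂ (root-old r) , refl }

  -- One track vertex `c` next to core `k` joins that core. The new window is a parameter, so both
  -- ends of a track share the argument. If `c` touches `C`, it becomes the attachment vertex;
  -- otherwise the old one stays.
  module Absorb {M q C} (A : Attached M q C C) {e t} (te : Model.tr M e ≡ just t)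
                {k} (at-k : At k e) {c d} (c-rest : Model.lab M c ≡ rest e)
                (d-core : Model.lab M d ≡ core k) (cd : Adj G c d)
                {lo′ hi′} (valid′ : Valid (UpdV.upd c (core k) (Model.lab M)) e (window t lo′ hi′))
                (inner′ : ∀ {x} → x ≢ c → Inner t x → Inner (window t lo′ hi′) x) where
    open Model M
    open Attached A

    t′ : Track
    t′ = window t lo′ hi′

    lab′ : V → Lab
    lab′ = UpdV.upd c (core k) lab

    lab-keep : ∀ {x l} → lab x ≡ l → l ≢ rest e → lab′ x ≡ l
    lab-keep eq ne = trans (UpdV.upd-other c (core k) lab
      (λ { refl → ne (trans (≡-sym eq) c-rest) })) eq

    tr′ : E → Maybe Track
    tr′ = UpdE.upd e (just t′) tr

    M′ : Model
    M′ = record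
      { root = root ; tr = tr′ ; lab = lab′ ; root-v = root-v
      ; core-rooted = rooted ; tr-edge = edge ; tr-valid = valid ; rest-tr = rest-tr′ }
      where
      rooted : ∀ {x l} → lab′ x ≡ core l → ∃ λ ρ → root l ≡ just ρ ×
               WalkIn G (λ z → lab′ z ≡ core l) x ρ
      rooted {x} eq with UpdV.upd-inv c (core k) lab x eq
      ... | inj₂ (_ , old) with core-rooted old
      ...   | ρ , r , w = ρ , r , walk-map (λ _ z → lab-keep z λ ()) w
      rooted {x} eq | inj₁ (refl , refl) with core-rooted d-core
      ...   | ρ , r , w = ρ , r , step eq cd (walk-map (λ _ z → lab-keep z λ ()) w)
      edge : ∀ {f s} → tr′ f ≡ just s → isEdge f ≡ true
      edge {f} eq with UpdE.upd-inv e (just t′) tr f eq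
      ... | inj₁ (refl , _) = tr-edge te
      ... | inj₂ (_ , old) = tr-edge old
      valid : ∀ {f s} → tr′ f ≡ just s → Valid lab′ f s
      valid {f} eq with UpdE.upd-inv e (just t′) tr f eq
      ... | inj₁ (refl , refl) = valid′
      ... | inj₂ (f≢e , old) = valid-map (λ _ z → lab-keep z λ ())
              (λ z → lab-keep z (f≢e ∘ rest-injective)) (tr-valid old)
      rest-tr′ : ∀ {x f} → lab′ x ≡ rest f → ∃ λ s → tr′ f ≡ just s × Inner s x
      rest-tr′ {x} {f} eq with UpdV.upd-inv c (core k) lab x eq
      ... | inj₂ (x≢c , old) with rest-tr old
      ...   | s , eq′ , inn = split (f ≟ᴱ e)
        where
        split : Dec (f ≡ e) → ∃ λ s → tr′ f ≡ just s × Inner s x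
        split (no f≢e) = s , trans (UpdE.upd-other e (just t′) tr f≢e) eq′ , inn
        split (yes refl) with trans (≡-sym te) eq′
        ... | refl = t′ , UpdE.upd-same e (just t′) tr , inner′ x≢c inn

    iso′ : ∀ {f s} → tr′ f ≡ just s → Isometric C (at s) (len s)
    iso′ {f} eq with UpdE.upd-inv e (just t′) tr f eq
    ... | inj₁ (refl , refl) = iso te
    ... | inj₂ (_ , old) = iso old

    fresh′ : ∀ {x} → C x ≡ true → lab′ x ≡ none
    fresh′ Cx = lab-keep (fresh Cx) λ ()

    cover′ : ∀ q′ {l} → q′ l ≡ q l → Cover tr q l → Cover tr′ q′ l
    cover′ q′ q≡ (inj₁ i) = inj₁ i
    cover′ q′ q≡ (inj₂ (inj₁ (f , isF , eq , a))) = inj₂ (inj₁ (f , isF ,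
      trans (UpdE.upd-other e (just t′) tr (λ { refl → just≢nothing te eq })) eq , a))
    cover′ q′ {l} q≡ (inj₂ (inj₂ (f , s , i , eq , a , le , at≡))) = split (f ≟ᴱ e)
      where
      split : Dec (f ≡ e) → Cover tr′ q′ l
      split (no f≢e) = inj₂ (inj₂ (f , s , i ,
        trans (UpdE.upd-other e (just t′) tr f≢e) eq , a , le , trans at≡ (≡-sym q≡)))
      split (yes refl) with trans (≡-sym te) eq
      ... | refl = inj₂ (inj₂ (e , t′ , i , UpdE.upd-same e (just t′) tr , a , le ,
                     trans at≡ (≡-sym q≡)))

    stay-attached : ¬ Touch C c → Attached M′ q C C
    stay-attached dead = record
      { q-core = λ r → lab-keep (q-core r) λ ()
      ; fresh = fresh′ ; boundary = boundary′ ; iso = iso′ ; cover = λ r → cover′ q refl (cover r) }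
      where
      boundary′ : ∀ {x} → Near C x → C x ≡ false →
                  (∃ λ l → lab′ x ≡ core l × x ≡ q l) ⊎ (∃ λ f → lab′ x ≡ rest f)
      boundary′ (inj₁ Cx) ¬Cx = contradiction ¬Cx (true≢false Cx)
      boundary′ near@(inj₂ touch) ¬Cx with boundary near ¬Cx
      ... | inj₁ (l , z , eq) = inj₁ (l , lab-keep z (λ ()) , eq)
      ... | inj₂ (f , z) =
              inj₂ (f , trans (UpdV.upd-other c (core k) lab (λ { refl → dead touch })) z)

    module Move (i : ℕ) (i≤len : i ≤ len t) (at-i : at t i ≡ c)
                (q-dead : ¬ Touch C (q k)) (alive : Touch C c) where

      q′ : W → V
      q′ = UpdW.upd k c q

      attached′ : Attached M′ q′ C C
      attached′ = record
        { q-core = q-core′ ; fresh = fresh′ ; boundary = boundary′ ; iso = iso′ ; cover = cover″ }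
        where
        q-core′ : ∀ {l ρ} → root l ≡ just ρ → lab′ (q′ l) ≡ core l
        q-core′ {l} r with l Fin.≟ k
        ... | yes refl = UpdV.upd-same c (core k) lab
        ... | no _ = lab-keep (q-core r) λ ()
        boundary′ : ∀ {x} → Near C x → C x ≡ false →
                    (∃ λ l → lab′ x ≡ core l × x ≡ q′ l) ⊎ (∃ λ f → lab′ x ≡ rest f)
        boundary′ (inj₁ Cx) ¬Cx = contradiction ¬Cx (true≢false Cx)
        boundary′ {x} near@(inj₂ touch) ¬Cx = split (x Fin.≟ c)
          where
          split : Dec (x ≡ c) → (∃ λ l → lab′ x ≡ core l × x ≡ q′ l) ⊎ (∃ λ f → lab′ x ≡ rest f)
          split (yes refl) =
            inj₁ (k , UpdV.upd-same c (core k) lab , ≡-sym (UpdW.upd-same k c q))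
          split (no x≢c) with boundary near ¬Cx
          ... | inj₂ (f , z) = inj₂ (f , trans (UpdV.upd-other c (core k) lab x≢c) z)
          -- The old `q k` has lost contact, so this vertex touching `C` lies in the core of some
          -- `l` other than `k`.
          ... | inj₁ (l , z , refl) = inj₁ (l , lab-keep z (λ ()) ,
                  ≡-sym (UpdW.upd-other k c q (λ { refl → q-dead touch })))
        cover″ : ∀ {l ρ} → root l ≡ just ρ → Cover tr′ q′ l
        cover″ {l} r = split (l Fin.≟ k)
          where
          split : Dec (l ≡ k) → Cover tr′ q′ l
          split (no l≢k) = cover′ q′ (UpdW.upd-other k c q l≢k) (cover r)
          split (yes refl) = inj₂ (inj₂ (e , t′ , i , UpdE.upd-same e (just t′) tr , at-k , i≤len ,
                               trans at-i (≡-sym (UpdW.upd-same k c q))))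

      restored : Restored M q C k
      restored = record
        { M′ = M′ ; q′ = q′ ; attached = attached′
        ; touched = λ _ → subst (Touch C) (≡-sym (UpdW.upd-same k c q)) alive
        ; others = λ l≢k r → r , UpdW.upd-other k c q l≢k }

    -- Absorbing changes no root, so a restoration carried out afterwards also serves the model
    -- before it.
    after : Restored M′ q C k → Restored M q C k
    after R = record { Restored R }

  core≢rest : ∀ {l f} → core l ≢ rest f
  core≢rest ()

  -- The core at the low end of the track swallows it up to the first vertex touching C.
  slide-lo : ∀ d i {M q C e t} → Attached M q C C → (te : Model.tr M e ≡ just t) →
             ¬ Touch C (q (proj₁ e)) → i ≡ d + suc (lo t) → i < hi t → Touch C (at t i) →
             Restored M q C (proj₁ e)
  slide-lo d i {M} {q} {C} {e} {t} A te q-dead i≡ i<hi alive = advance d i≡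
    where
    open Model M
    open Valid (tr-valid te)
    c = at t (suc (lo t))
    lab′ = UpdV.upd c (core (proj₁ e)) lab
    t′ = window t (suc (lo t)) (hi t)
    lt : suc (lo t) < hi t
    lt = ≤-<-trans (≤-trans (m≤n+m _ d) (≤-reflexive (≡-sym i≡))) i<hi
    c-rest : lab c ≡ rest e
    c-rest = inner ≤-refl lt
    valid′ : Valid lab′ e t′
    valid′ = record
      { lo<hi = lt ; hi≤len = hi≤len
      ; lo-core = UpdV.upd-same c _ lab
      ; hi-core = trans (UpdV.upd-other c _ lab (λ eq →
          core≢rest (trans (≡-sym hi-core) (trans (cong lab eq) c-rest)))) hi-core
      ; inner = λ p l → trans (UpdV.upd-other c _ lab (λ eq →
          <⇒≢ p (≡-sym (distinct (<-trans ≤-refl p) l ≤-refl lt eq)))) (inner (<-trans ≤-refl p) l)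
      ; linked = λ p l → linked (<⇒≤ p) l
      ; distinct = λ p l p′ l′ → distinct (<-trans ≤-refl p) l (<-trans ≤-refl p′) l′ }
    inner′ : ∀ {x} → x ≢ c → Inner t x → Inner t′ x
    inner′ x≢c (i , p , l , refl) = i , ≤∧≢⇒< p (λ { refl → x≢c refl }) , l , refl
    module Abs = Absorb A te (inj₁ refl) c-rest lo-core (Adj-sym (linked ≤-refl lo<hi)) valid′ inner′
    found : Touch C c → Restored M q C (proj₁ e)
    found = Abs.Move.restored (suc (lo t)) (≤-trans lo<hi hi≤len) refl q-dead
    advance : ∀ d → i ≡ d + suc (lo t) → Restored M q C (proj₁ e)
    -- At `d` zero, `c` is the vertex of index `i`, known to touch `C`; this ends the search.
    advance zero refl = found alive
    advance (suc d) i≡ with touch? C c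
    ... | yes alive-c = found alive-c
    ... | no dead = Abs.after (slide-lo d i (Abs.stay-attached dead)
            (UpdE.upd-same e (just t′) tr) q-dead
            (trans i≡ (≡-sym (+-suc d (suc (lo t))))) i<hi alive)

  -- Mirror image of `slide-lo`: the window closes from above, and `d` is the distance from `i` to
  -- the last unabsorbed index.
  slide-hi : ∀ d i {M q C e t} → Attached M q C C → (te : Model.tr M e ≡ just t) →
             ¬ Touch C (q (proj₂ e)) → hi t ≡ suc (d + i) → lo t < i → Touch C (at t i) →
             Restored M q C (proj₂ e)
  slide-hi d i {M} {q} {C} {e} {t} A te q-dead hi≡ lo<i alive = advance d refl
    where
    open Model M
    open Valid (tr-valid te)
    h = d + i
    c = at t h
    lab′ = UpdV.upd c (core (proj₂ e)) lab
    t′ = window t (lo t) h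
    lo<h : lo t < h
    lo<h = <-≤-trans lo<i (m≤n+m i d)
    h<hi : h < hi t
    h<hi = ≤-reflexive (≡-sym hi≡)
    h≤len : h ≤ len t
    h≤len = ≤-trans (<⇒≤ h<hi) hi≤len
    c-rest : lab c ≡ rest e
    c-rest = inner lo<h h<hi
    below : ∀ {i} → i < h → i < hi t
    below l = <-trans l h<hi
    valid′ : Valid lab′ e t′
    valid′ = record
      { lo<hi = lo<h ; hi≤len = h≤len
      ; lo-core = trans (UpdV.upd-other c _ lab (λ eq →
          core≢rest (trans (≡-sym lo-core) (trans (cong lab eq) c-rest)))) lo-core
      ; hi-core = UpdV.upd-same c _ lab
      ; inner = λ p l → trans (UpdV.upd-other c _ lab (λ eq →
          <⇒≢ l (distinct p (below l) lo<h h<hi eq))) (inner p (below l))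
      ; linked = λ p l → linked p (below l)
      ; distinct = λ p l p′ l′ → distinct p (below l) p′ (below l′) }
    inner′ : ∀ {x} → x ≢ c → Inner t x → Inner t′ x
    inner′ x≢c (i , p , l , refl) =
      i , p , ≤∧≢⇒< (s≤s⁻¹ (subst (i <_) hi≡ l)) (λ { refl → x≢c refl }) , refl
    module Abs = Absorb A te (inj₂ refl) c-rest hi-core
                   (subst (λ m → Adj G c (at t m)) (≡-sym hi≡) (linked (<⇒≤ lo<h) h<hi)) valid′ inner′
    found : Touch C c → Restored M q C (proj₂ e)
    found = Abs.Move.restored h h≤len refl q-dead
    advance : ∀ d → h ≡ d + i → Restored M q C (proj₂ e)
    advance zero eq = found (subst (Touch C ∘ at t) (≡-sym eq) alive)
    advance (suc d) eq with touch? C c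
    ... | yes alive-c = found alive-c
    ... | no dead = Abs.after (slide-hi d i (Abs.stay-attached dead)
            (UpdE.upd-same e (just t′) tr) q-dead eq lo<i alive)

  rest-at? : ∀ k l → Dec (∃ λ e → l ≡ rest e × At k e)
  rest-at? k none = no λ ()
  rest-at? k (core l) = no λ ()
  rest-at? k (rest e) = map′ (λ a → e , refl , a) (λ { (_ , refl , a) → a }) (at? k e)

  -- If `q k` has lost contact, either some unabsorbed vertex of a track at `k` touches `C` and the
  -- core slides towards it from its own end of the track, or `k` is dropped.
  restore : ∀ {M q C} → Attached M q C C → ∀ k → Restored M q C k
  restore {M} {q} {C} A k with touch? C (q k)
  ... | yes alive = record
          { M′ = M ; q′ = q ; attached = A ; touched = λ _ → alive ; others = λ _ r → r , refl }
  ... | no dead with Fin.any? (λ x → touch? C x ×-dec rest-at? k (Model.lab M x))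
  ...   | no none-alive = Drop.restored A k dead (λ eq a touch → none-alive (_ , touch , _ , eq , a))
  ...   | yes (x , alive , e , eq , a) with Model.rest-tr M eq | a
  ...     | t , te , i , lo<i , i<hi , refl | inj₁ refl =
              slide-lo (i ∸ suc (lo t)) i A te dead (≡-sym (m∸n+n≡m lo<i)) i<hi alive
  ...     | t , te , i , lo<i , i<hi , refl | inj₂ refl =
              slide-hi (hi t ∸ suc i) i A te dead
                (≡-sym (trans (≡-sym (+-suc _ i)) (m∸n+n≡m i<hi))) lo<i alive

  restore-all : ∀ {M q C} → Attached M q C C → State C
  restore-all {M} {q} {C} A = record
    { M = proj₁ processed ; q = proj₁ (proj₂ processed) ; attached = proj₁ (proj₂ (proj₂ processed))
    ; touches = proj₂ (proj₂ (proj₂ processed)) (∈-allFin _) }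
    where
    go : ∀ ks → ∃ λ M′ → ∃ λ q′ → Attached M′ q′ C C ×
         (∀ {k ρ} → k ∈ ks → Model.root M′ k ≡ just ρ → Touch C (q′ k))
    go [] = M , q , A , λ ()
    go (k ∷ ks) with go ks
    ... | M₁ , q₁ , A₁ , alive with restore A₁ k
    ...   | R = M′ , q′ , attached , alive′
      where
      open Restored R
      alive′ : ∀ {l ρ} → l ∈ k ∷ ks → Model.root M′ l ≡ just ρ → Touch C (q′ l)
      alive′ {l} l∈ r with l Fin.≟ k | l∈
      ... | yes refl | _ = touched r
      ... | no l≢k | here eq = contradiction eq l≢k
      ... | no l≢k | there l∈ks with others l≢k r
      -- Treating `k` kept `q l` for every other surviving `l`, so contacts already secured remain.
      ...   | r₁ , q≡ = subst (Touch C) (≡-sym q≡) (alive l∈ks r₁)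
    processed = go (allFin (n H))

  -- The minor given by a complete model.

  module Minor {C} (S : State C) (conn : ∀ x y → C x ≡ true → C y ≡ true → WalkIn G (λ z → C z ≡ true) x y)
               {y₀} (Cy₀ : C y₀ ≡ true)
               (rooted : ∀ k → k ≢ v → ∃ λ ρ → Model.root (State.M S) k ≡ just ρ)
               (tracked : ∀ e → isEdge e ≡ true → ∃ λ t → Model.tr (State.M S) e ≡ just t) where
    open State S
    open Model M
    open Attached attached

    -- The unabsorbed part of a track goes to its first end; unlabelled vertices belong to `v`
    -- inside `C` and to no branch set elsewhere.
    branch : Lab → Bool → Maybe W
    branch none b = if b then just v else nothing
    branch (core k) _ = just k
    branch (rest e) _ = just (proj₁ e)

    f : V → Maybe W
    f x = branch (lab x) (C x)

    f-core : ∀ {x k} → lab x ≡ core k → f x ≡ just k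
    f-core {x} eq = cong (λ l → branch l (C x)) eq

    f-rest : ∀ {x e} → lab x ≡ rest e → f x ≡ just (proj₁ e)
    f-rest {x} eq = cong (λ l → branch l (C x)) eq

    f-C : ∀ {x} → C x ≡ true → f x ≡ just v
    f-C Cx = cong₂ branch (fresh Cx) Cx

    f-inv : ∀ {x k} → f x ≡ just k →
            lab x ≡ core k ⊎ (∃ λ e → lab x ≡ rest e × proj₁ e ≡ k) ⊎ (k ≡ v × C x ≡ true)
    f-inv {x} eq with lab x | C x
    f-inv refl | none | true = inj₂ (inj₂ (refl , refl))
    f-inv refl | core k | _ = inj₁ refl
    f-inv refl | rest e | _ = inj₂ (inj₁ (e , refl , refl))

    f-v : ∀ {x} → f x ≡ just v → C x ≡ true
    f-v eq with f-inv eq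
    ... | inj₁ c with core-rooted c
    ...   | ρ , r , _ = contradiction root-v (just≢nothing r)
    f-v eq | inj₂ (inj₂ (_ , Cx)) = Cx
    f-v eq | inj₂ (inj₁ (e , c , e₁≡v)) with rest-tr c
    ...   | t , te , _ = contradiction e₁≡v (proj₁ (isEdge⇒≢ e (tr-edge te)))

    core-walk : ∀ {x k} → lab x ≡ core k → ∃ λ ρ → root k ≡ just ρ × WalkIn G (λ z → f z ≡ just k) x ρ
    core-walk c with core-rooted c
    ... | ρ , r , w = ρ , r , walk-map (λ _ → f-core) w

    -- Descending the window reaches the core of the first end, which connects that branch set.
    down : ∀ {e t} → tr e ≡ just t → ∀ d → d + lo t < hi t → ∃ λ ρ → root (proj₁ e) ≡ just ρ ×
           WalkIn G (λ z → f z ≡ just (proj₁ e)) (at t (d + lo t)) ρ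
    down te zero lt = core-walk (Valid.lo-core (tr-valid te))
    down {e} {t} te (suc d) lt with down te d (<-trans ≤-refl lt)
    ... | ρ , r , w = ρ , r , step (f-rest (Valid.inner (tr-valid te) (s≤s (m≤n+m _ d)) lt))
            (Adj-sym (Valid.linked (tr-valid te) (m≤n+m _ d) (<-trans ≤-refl lt))) w

    to-root : ∀ {x k} → k ≢ v → f x ≡ just k → ∃ λ ρ → root k ≡ just ρ × WalkIn G (λ z → f z ≡ just k) x ρ
    to-root k≢v eq with f-inv eq
    ... | inj₁ c = core-walk c
    ... | inj₂ (inj₂ (k≡v , _)) = contradiction k≡v k≢v
    ... | inj₂ (inj₁ (e , c , refl)) with rest-tr c
    ...   | t , te , i , lo<i , i<hi , refl with down te (i ∸ lo t) (≤-<-trans (≤-reflexive (m∸n+n≡m (<⇒≤ lo<i))) i<hi)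
    ...     | ρ , r , w = ρ , r , subst (λ m → WalkIn G _ (at t m) ρ) (m∸n+n≡m (<⇒≤ lo<i)) w

    f-q : ∀ {k} → k ≢ v → f (q k) ≡ just k
    f-q {k} k≢v = f-core (q-core (proj₂ (rooted k k≢v)))

    -- The last edge of the window joins the two branch sets, since the window below `hi` went to
    -- the first end.
    crossing : ∀ {e} → isEdge e ≡ true → ∃ λ x → ∃ λ y → f x ≡ just (proj₁ e) × f y ≡ just (proj₂ e) × Adj G x y
    crossing {e} isE with tracked e isE
    ... | t , te = cross (hi t) refl
      where
      open Valid (tr-valid te)
      cross : ∀ h → hi t ≡ h → _
      cross zero eq = contradiction (subst (lo t <_) eq lo<hi) (λ ())
      cross (suc h) eq = at t h , at t (suc h) , low
                       , f-core (subst (λ m → lab (at t m) ≡ core (proj₂ e)) eq hi-core)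
                       , linked lo≤h h<hi
        where
        h<hi : h < hi t
        h<hi = ≤-reflexive (≡-sym eq)
        lo≤h : lo t ≤ h
        lo≤h = s≤s⁻¹ (subst (lo t <_) eq lo<hi)
        low : f (at t h) ≡ just (proj₁ e)
        -- If the window has no inner vertex, the lower end of this edge is the core vertex at `lo`.
        low with m≤n⇒m<n∨m≡n lo≤h
        ... | inj₁ lo<h = f-rest (inner lo<h h<hi)
        ... | inj₂ refl = f-core lo-core

    minor : IsMinor H G
    minor = record { f = f ; nonempty = nonempty ; connected = connected ; edges = edges }
      where
      nonempty : ∀ k → ∃ λ x → f x ≡ just k
      nonempty k with k Fin.≟ v
      ... | yes refl = y₀ , f-C Cy₀
      ... | no k≢v = q k , f-q k≢v
      connected : ∀ k x y → f x ≡ just k → f y ≡ just k → WalkIn G (λ z → f z ≡ just k) x y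
      connected k x y fx fy with k Fin.≟ v
      ... | yes refl = walk-map (λ _ → f-C) (conn x y (f-v fx) (f-v fy))
      ... | no k≢v with to-root k≢v fx | to-root k≢v fy
      ...   | ρ , r , w | ρ′ , r′ , w′ with trans (≡-sym r) r′
      ...     | refl = walk-trans w (walk-sym w′)
      edges : ∀ i j → Adj H i j → ∃ λ x → ∃ λ y → f x ≡ just i × f y ≡ just j × Adj G x y
      edges i j a with i Fin.≟ v | j Fin.≟ v
      ... | yes refl | yes refl = contradiction (irrefl H i) (true≢false a)
      ... | yes refl | no j≢v with touches (proj₂ (rooted j j≢v))
      ...   | z , Cz , az = z , q j , f-C Cz , f-q j≢v , az
      edges i j a | no i≢v | yes refl with touches (proj₂ (rooted i i≢v))
      ...   | z , Cz , az = q i , z , f-q i≢v , f-C Cz , Adj-sym az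
      edges i j a | no i≢v | no j≢v with adj⇒isEdge a i≢v j≢v
      ...   | inj₁ isE = crossing isE
      ...   | inj₂ isE with crossing isE
      ...     | x , y , fx , fy , xy = y , x , fy , fx , Adj-sym xy

  -- One round of placement.

  nothing? : ∀ {A : Set} (m : Maybe A) → Dec (m ≡ nothing)
  nothing? nothing = yes refl
  nothing? (just _) = no λ ()

  ≢nothing : ∀ {A : Set} {m : Maybe A} → m ≢ nothing → ∃ λ a → m ≡ just a
  ≢nothing {m = nothing} ne = contradiction refl ne
  ≢nothing {m = just a} _ = a , refl

  -- `P` is the set placed in one round; its member `y` makes the recursion on unplaced vertices
  -- decrease.
  record Extension (C : V → Bool) : Set where
    field
      M        : Model
      q        : W → V
      P        : V → Bool
      P⊆C      : ∀ {x} → P x ≡ true → C x ≡ true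
      y        : V
      Py       : P y ≡ true
      attached : Attached M q C (C ∖ P)

  -- Missing cores come before missing tracks, because a new track needs the cores of both ends.
  -- With neither missing, the model is complete and yields the excluded minor.
  extend : ¬ IsMinor H G → ∀ {C} → State C →
           (∀ x y → C x ≡ true → C y ≡ true → WalkIn G (λ z → C z ≡ true) x y) →
           ∀ {y} → C y ≡ true → Extension C
  extend noMinor {C} S conn {y} Cy
    with Fin.any? (λ k → ¬? (k Fin.≟ v) ×-dec nothing? (Model.root (State.M S) k))
  ... | yes (k , k≢v , unrooted) = record
          { M = M′ ; q = q′ ; P = P ; y = y ; attached = A′
          ; P⊆C = λ {x} p → subst (λ z → C z ≡ true) (≡-sym (⌊⌋-true⁻¹ (x Fin.≟ y) p)) Cy
          ; Py = ⌊⌋-true (y Fin.≟ y) refl }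
    where open AddVertex (State.attached S) k≢v unrooted Cy
  ... | no all-rooted
    with Fin.any? (λ i → Fin.any? (λ j → (isEdge (i , j) Bool.≟ true)
                                          ×-dec nothing? (Model.tr (State.M S) (i , j))))
  ...   | no all-tracked = contradiction
            (Minor.minor S conn Cy (λ k k≢v → ≢nothing (λ r → all-rooted (k , k≢v , r)))
              (λ (i , j) isE → ≢nothing (λ t → all-tracked (i , j , isE , t))))
            noMinor
  ...   | yes (i , j , isE , free) = record
            { M = M′ ; q = State.q S ; P = P ; P⊆C = P⊆C
            -- Index 1 is interior to the route, hence a newly placed vertex.
            ; y = Route.pt R 1 ; Py = inner-P ≤-refl (Route.1<ℓ R) ; attached = A′ }
    where
    open State S using (M; q; touches)
    open Attached (State.attached S) using (q-core; fresh)
    rooted : ∀ k → k ≢ v → ∃ λ ρ → Model.root M k ≡ just ρ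
    rooted k k≢v = ≢nothing (λ r → all-rooted (k , k≢v , r))
    rᵢ = rooted i (proj₁ (isEdge⇒≢ (i , j) isE))
    rⱼ = rooted j (proj₂ (isEdge⇒≢ (i , j) isE))
    outside : ∀ {k ρ} → Model.root M k ≡ just ρ → C (q k) ≡ false
    outside r = ≢true⇒≡false (λ c → core≢none (trans (≡-sym (q-core r)) (fresh c)))
      where
      core≢none : ∀ {l} → core l ≢ none
      core≢none ()
    R : Route C (q i) (q j)
    R = route conn (outside (proj₂ rᵢ)) (outside (proj₂ rⱼ)) (touches (proj₂ rᵢ)) (touches (proj₂ rⱼ))
    open AddTrack (State.attached S) isE free (proj₂ rᵢ) (proj₂ rⱼ) R

  -- Slots and the bound on reachable vertices.

  module Count (r : ℕ) (1≤r : 1 ≤ r) where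

    p : ℕ
    p = 2 * r + 1

    instance
      p-nonZero : NonZero p
      p-nonZero = >-nonZero (m≤n+m 1 (2 * r))

    Slot : Set
    Slot = (E × ℕ) ⊎ W

    edgeSlots : W → W → List Slot
    edgeSlots i j = if isEdge (i , j) then map (λ o → inj₁ ((i , j) , o)) (upTo p) else []

    isolatedSlots : W → List Slot
    isolatedSlots u = if isIsolated u then inj₂ u ∷ [] else []

    -- One slot for each edge of H - v and each residue modulo `2 * r + 1`, and one for each
    -- isolated vertex: in number, exactly the claimed bound.
    slots : List Slot
    slots = concatMap (λ i → concatMap (edgeSlots i) (allFin (n H))) (allFin (n H))
            ++ concatMap isolatedSlots (allFin (n H))

    bound : ℕ
    bound = edgesMinus H v * p + isolatedMinus H v

    length-slots : length slots ≡ bound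
    length-slots = trans (length-++ (concatMap (λ i → concatMap (edgeSlots i) (allFin (n H))) (allFin (n H))))
      (cong₂ _+_ edges-part isolated-part)
      where
      open ≡-Reasoning
      length-edgeSlots : ∀ i j → length (edgeSlots i j) ≡ b2n (isEdge (i , j)) * p
      length-edgeSlots i j with isEdge (i , j)
      ... | false = refl
      ... | true = trans (length-map _ (upTo p)) (trans (length-upTo p) (≡-sym (+-identityʳ p)))
      length-isolatedSlots : ∀ u → length (isolatedSlots u) ≡ b2n (isIsolated u)
      length-isolatedSlots u with isIsolated u
      ... | false = refl
      ... | true = refl
      length-row : ∀ i → length (concatMap (edgeSlots i) (allFin (n H))) ≡
                   sum (map (λ j → b2n (isEdge (i , j))) (allFin (n H))) * p
      length-row i = begin
        length (concatMap (edgeSlots i) (allFin (n H)))              ≡⟨ length-concatMap (edgeSlots i) (allFin (n H)) ⟩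
        sum (map (length ∘ edgeSlots i) (allFin (n H)))              ≡⟨ cong sum (map-cong (length-edgeSlots i) (allFin (n H))) ⟩
        sum (map (λ j → b2n (isEdge (i , j)) * p) (allFin (n H)))    ≡⟨ sum-map-* _ p (allFin (n H)) ⟩
        sum (map (λ j → b2n (isEdge (i , j))) (allFin (n H))) * p    ∎
      edges-part : length (concatMap (λ i → concatMap (edgeSlots i) (allFin (n H))) (allFin (n H)))
                   ≡ edgesMinus H v * p
      edges-part = trans (length-concatMap _ (allFin (n H)))
        (trans (cong sum (map-cong length-row (allFin (n H)))) (sum-map-* _ p (allFin (n H))))
      isolated-part : length (concatMap isolatedSlots (allFin (n H))) ≡ isolatedMinus H v
      isolated-part = trans (length-concatMap isolatedSlots (allFin (n H)))
        (cong sum (map-cong length-isolatedSlots (allFin (n H))))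

    edge-slot : ∀ {e o} → isEdge e ≡ true → o < p → inj₁ (e , o) ∈ slots
    edge-slot {i , j} {o} isE o<p =
      ∈-++⁺ˡ (∈-concatMap⁺ _ (lose (∈-allFin i) (∈-concatMap⁺ _ (lose (∈-allFin j) here-slot))))
      where
      here-slot : inj₁ ((i , j) , o) ∈ edgeSlots i j
      here-slot rewrite isE = ∈-map⁺ _ (∈-upTo⁺ o<p)

    isolated-slot : ∀ {k} → isIsolated k ≡ true → inj₂ k ∈ slots
    isolated-slot {k} isI = ∈-++⁺ʳ (concatMap (λ i → concatMap (edgeSlots i) (allFin (n H))) (allFin (n H)))
      (∈-concatMap⁺ _ (lose (∈-allFin k) here-slot))
      where
      here-slot : inj₂ k ∈ isolatedSlots k
      here-slot rewrite isI = here refl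

    -- A vertex on a track is determined by its index modulo 2r+1, and the slots of an edge
    -- without a track are free to host the attachment vertices of its two ends.
    data HasSlot (M : Model) (q : W → V) (u : V) : Slot → Set where
      on-track : ∀ {e t i} → Model.tr M e ≡ just t → i ≤ len t → at t i ≡ u →
                 HasSlot M q u (inj₁ (e , i % p))
      low-end  : ∀ {e} → isEdge e ≡ true → Model.tr M e ≡ nothing → q (proj₁ e) ≡ u →
                 HasSlot M q u (inj₁ (e , 0))
      high-end : ∀ {e} → isEdge e ≡ true → Model.tr M e ≡ nothing → q (proj₂ e) ≡ u →
                 HasSlot M q u (inj₁ (e , 1))
      isolated : ∀ {k} → isIsolated k ≡ true → q k ≡ u → HasSlot M q u (inj₂ k)

    Reach : (V → Bool) → V → V → Set
    Reach C y u = ∃ λ a → a ≤ r × OutIn C a y u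

    module _ {M q C D} (A : Attached M q C D) where
      open Model M
      open Attached A

      slot-listed : ∀ {u s} → HasSlot M q u s → s ∈ slots
      slot-listed (on-track {i = i} te _ _) = edge-slot (tr-edge te) (m%n<n i p)
      slot-listed (low-end isE _ _) = edge-slot isE (m≤n+m 1 (2 * r))
      -- Slot 1 of an edge exists because `1 ≤ r` makes `p` larger than 1.
      slot-listed (high-end isE _ _) = edge-slot isE (+-monoˡ-≤ 1 (≤-trans 1≤r (m≤m+n r _)))
      slot-listed (isolated isI _) = isolated-slot isI

      -- Isometry and two walks of length at most `r` keep the indices within `2 * r`, which is less
      -- than `p`.
      track-index : ∀ {e t i j} → tr e ≡ just t → i ≤ len t → j ≤ len t →
                    ∀ {y} → C y ≡ true → Reach C y (at t i) → Reach C y (at t j) → j < i + p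
      track-index {i = i} te i≤ j≤ Cy (a , a≤r , o) (b , b≤r , o′) = ≤-<-trans (iso te Cy i≤ j≤ o o′)
        (+-monoʳ-< i (≤-<-trans (+-mono-≤ a≤r (≤-trans b≤r (≤-reflexive (≡-sym (+-identityʳ r)))))
                                (m<m+n (2 * r) z<s)))

      -- An edge with a track hosts only vertices of that track, told apart by residues; an edge
      -- without one hosts only the attachment vertices of its ends, in slots 0 and 1.
      slot-injective : ∀ {y} → C y ≡ true → ∀ {u u′ s} → Reach C y u → Reach C y u′ →
                       HasSlot M q u s → HasSlot M q u′ s → u ≡ u′
      slot-injective Cy {u} {u′} ru ru′ h h′ = same h h′ refl
        where
        same : ∀ {s s′} → HasSlot M q u s → HasSlot M q u′ s′ → s ≡ s′ → u ≡ u′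
        same (on-track {t = t} te le refl) (on-track te′ le′ refl) eq
          with cong proj₁ (inj₁-injective eq)
        ... | refl with trans (≡-sym te) te′
        ...   | refl = cong (at t) (%-injective p (track-index te le′ le Cy ru′ ru)
                         (track-index te le le′ Cy ru ru′) (cong proj₂ (inj₁-injective eq)))
        same (on-track te _ _) (low-end _ free _) eq with cong proj₁ (inj₁-injective eq)
        ... | refl = contradiction free (just≢nothing te)
        same (on-track te _ _) (high-end _ free _) eq with cong proj₁ (inj₁-injective eq)
        ... | refl = contradiction free (just≢nothing te)
        same (low-end _ free _) (on-track te _ _) eq with cong proj₁ (inj₁-injective eq)
        ... | refl = contradiction free (just≢nothing te)
        same (high-end _ free _) (on-track te _ _) eq with cong proj₁ (inj₁-injective eq)
        ... | refl = contradiction free (just≢nothing te)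
        same (low-end _ _ refl) (low-end _ _ refl) refl = refl
        same (high-end _ _ refl) (high-end _ _ refl) refl = refl
        same (low-end _ _ _) (high-end _ _ _) ()
        same (high-end _ _ _) (low-end _ _ _) ()
        same (isolated _ refl) (isolated _ refl) refl = refl

      -- The reached vertex lies in `C` or has a neighbour there, so `boundary` makes it a track
      -- vertex or some `q k`; in the latter case `cover` supplies the slot.
      has-slot : ∀ {y u} → C y ≡ true → D u ≡ false → Reach C y u → ∃ (HasSlot M q u)
      has-slot {y} {u} Cy ¬Du (a , _ , o) with boundary (near a o) ¬Du
        where
        near : ∀ a → OutIn C a y u → Near C u
        near zero done = inj₁ Cy
        near (suc a) o with out-unsnoc o
        ... | z , Cz , zu , _ = inj₂ (z , Cz , zu)
      ... | inj₂ (e , c) with rest-tr c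
      ...   | t , te , i , _ , i<hi , at≡ =
                _ , on-track te (≤-trans (<⇒≤ i<hi) (Valid.hi≤len (tr-valid te))) at≡
      has-slot {y} {u} Cy ¬Du (a , _ , o) | inj₁ (k , c , refl)
        with cover (proj₁ (proj₂ (core-rooted c)))
      ... | inj₁ isI = _ , isolated isI refl
      ... | inj₂ (inj₁ (e , isE , free , inj₁ refl)) = _ , low-end isE free refl
      ... | inj₂ (inj₁ (e , isE , free , inj₂ refl)) = _ , high-end isE free refl
      ... | inj₂ (inj₂ (e , t , i , te , _ , le , at≡)) = _ , on-track te le at≡

      reach-bound : ∀ {y} → C y ≡ true → CardLe (λ u → D u ≡ false × Reach C y u) bound
      reach-bound Cy s g g-inj reached = ≤-trans
        (index-bound slots (proj₁ ∘ slot)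
          (λ {i} {j} eq → g-inj (slot-injective Cy (proj₂ (reached i)) (proj₂ (reached j))
            (proj₂ (slot i)) (subst (HasSlot M q (g j)) (≡-sym eq) (proj₂ (slot j)))))
          (slot-listed ∘ proj₂ ∘ slot))
        (≤-reflexive length-slots)
        where
        slot : ∀ i → ∃ (HasSlot M q (g i))
        slot i = has-slot Cy (proj₁ (reached i)) (proj₂ (reached i))

    -- Stages and the final order.

    Placed : (V → Bool) → V → Set
    Placed U y = ∃ λ C → C y ≡ true × Component U C × State C

    -- Strong reachability with the order coarsened to stages: vertices of one stage are not
    -- separated, and everything outside `U` counts as placed earlier.
    StageReach : (V → Bool) → (V → ℕ) → V → V → Set
    StageReach U t y u = (U u ≡ false ⊎ t u ≤ t y) ×
                         ∃ λ a → a ≤ r × Out (λ z → U z ≡ true × t y ≤ t z) a y u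

    -- A vertex outside `C′` with a neighbour in it cannot lie in `D`, as components are closed, so
    -- the old description of the boundary applies.
    restrict : ∀ {M q C D C′} → (∀ x → D x ≡ true → C x ≡ true) → Attached M q C D →
               Component D C′ → Attached M q C′ C′
    restrict {M} {q} {C} {D} {C′} D⊆C A K = record
      { q-core = q-core
      ; fresh = λ c → fresh (inside _ c)
      ; boundary = boundary′
      ; iso = λ te Cy i≤ j≤ o o′ → iso te (C′⊆C _ Cy) i≤ j≤ (out-map C′⊆C o) (out-map C′⊆C o′)
      ; cover = cover }
      where
      open Attached A
      open Component K
      C′⊆C : ∀ x → C′ x ≡ true → C x ≡ true
      C′⊆C x c = D⊆C x (inside x c)
      boundary′ : ∀ {x} → Near C′ x → C′ x ≡ false →
                  (∃ λ k → Model.lab M x ≡ core k × x ≡ q k) ⊎ (∃ λ e → Model.lab M x ≡ rest e)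
      boundary′ (inj₁ c) ¬c = contradiction ¬c (true≢false c)
      boundary′ {x} (inj₂ (z , Cz , zx)) ¬c = boundary (inj₂ (z , C′⊆C z Cz , zx))
        (≢true⇒≡false (λ d → true≢false (closed z x Cz d zx) ¬c))

    -- Each round extends the model of one component and places a set `P` there at stage 0; the
    -- remainder recurses with all stages raised by one. Every component carries its own model.
    stages : ¬ IsMinor H G → ∀ m U → ∥ U ∥ < m → (∀ y → U y ≡ true → Placed U y) →
             ∃ λ t → ∀ y → U y ≡ true → CardLe (StageReach U t y) bound
    stages noMinor (suc m) U size placed with Fin.any? (λ y → U y Bool.≟ true)
    ... | no empty = (λ _ → 0) , λ y Uy → contradiction (y , Uy) empty
    ... | yes (y₀ , Uy₀) with placed y₀ Uy₀
    ...   | C , Cy₀ , K , S with extend noMinor S (Component.connected K) Cy₀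
    ...     | X = t , good
      where
      open Extension X hiding (y)
      module K = Component K
      U′ : V → Bool
      U′ = U ∖ P
      P⊆U : ∀ {x} → P x ≡ true → U x ≡ true
      P⊆U Px = K.inside _ (P⊆C Px)
      U′⊆U : ∀ {x} → U′ x ≡ true → U x ≡ true
      U′⊆U = proj₁ ∘ ∖-true {U} {P}
      U′⊆P̅ : ∀ {x} → U′ x ≡ true → P x ≡ false
      U′⊆P̅ = proj₂ ∘ ∖-true {U} {P}

      placed′ : ∀ y → U′ y ≡ true → Placed U′ y
      placed′ y U′y = split (C y) refl
        where
        split : ∀ b → C y ≡ b → Placed U′ y
        -- The remainder of `C` breaks into components, each restoring its own copy of the extended
        -- model.
        split true Cy with component (C ∖ P) y (∖-intro {C} {P} Cy (U′⊆P̅ U′y))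
        ... | C′ , C′y , K′ = C′ , C′y
            , record
              { inside = λ x C′x → ∖-intro {U} {P} (K.inside x (proj₁ (split∖ C′x))) (proj₂ (split∖ C′x))
              ; closed = λ x z C′x U′z xz → Component.closed K′ x z C′x
                  (∖-intro {C} {P} (K.closed x z (proj₁ (split∖ C′x)) (U′⊆U U′z) xz) (U′⊆P̅ U′z)) xz
              ; connected = Component.connected K′ }
            , restore-all (restrict (λ _ → proj₁ ∘ ∖-true {C} {P}) attached K′)
          where
          split∖ : ∀ {x} → C′ x ≡ true → C x ≡ true × P x ≡ false
          split∖ C′x = ∖-true {C} {P} (Component.inside K′ _ C′x)
        -- The component of `y` survives unchanged: if it met `P`, its connectedness would put `y`
        -- in `C`.
        split false ¬Cy with placed y (U′⊆U U′y)
        ... | C′ , C′y , K′ , S′ = C′ , C′y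
            , record
              { inside = λ x C′x → ∖-intro {U} {P} (K′.inside x C′x) (≢true⇒≡false (λ Px →
                  true≢false (walk-closed K (P⊆C Px)
                    (walk-map K′.inside (K′.connected x y C′x C′y))) ¬Cy))
              ; closed = λ x z C′x U′z xz → K′.closed x z C′x (U′⊆U U′z) xz
              ; connected = K′.connected }
            , S′
          where module K′ = Component K′

      later = stages noMinor m U′
        (<-≤-trans (∥∥-strict U U′ (λ _ → U′⊆U) (Extension.y X) (P⊆U Py) (∖-out {U} {P} Py)) (s≤s⁻¹ size))
        placed′
      t′ = proj₁ later
      t : V → ℕ
      t x = if U′ x then suc (t′ x) else 0
      t-in : ∀ {x} → U′ x ≡ true → t x ≡ suc (t′ x)
      t-in eq rewrite eq = refl
      t-out : ∀ {x} → U′ x ≡ false → t x ≡ 0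
      t-out eq rewrite eq = refl

      good : ∀ y → U y ≡ true → CardLe (StageReach U t y) bound
      good y Uy s g g-inj reached = split (U′ y) refl
        where
        split : ∀ b → U′ y ≡ b → s ≤ bound
        split true U′y = proj₂ later y U′y s g g-inj (λ i → convert (reached i))
          where
          convert : ∀ {u} → StageReach U t y u → StageReach U′ t′ y u
          convert {u} (le , a , a≤r , o) = earlier (U′ u) refl le , a , a≤r , out-map inner o
            where
            earlier : ∀ b → U′ u ≡ b → U u ≡ false ⊎ t u ≤ t y → U′ u ≡ false ⊎ t′ u ≤ t′ y
            earlier false eq _ = inj₁ eq
            earlier true eq (inj₁ ¬Uu) = contradiction ¬Uu (true≢false (U′⊆U eq))
            earlier true eq (inj₂ le) = inj₂ (s≤s⁻¹ (subst₂ _≤_ (t-in eq) (t-in U′y) le))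
            inner : ∀ z → U z ≡ true × t y ≤ t z → U′ z ≡ true × t′ y ≤ t′ z
            inner z (_ , le) = here-z (U′ z) refl
              where
              here-z : ∀ b → U′ z ≡ b → U′ z ≡ true × t′ y ≤ t′ z
              here-z true eq = eq , s≤s⁻¹ (subst₂ _≤_ (t-in U′y) (t-in eq) le)
              -- A vertex outside `U′` has stage 0, too early for a walk whose start has positive
              -- stage.
              here-z false eq = contradiction (subst₂ _≤_ (t-in U′y) (t-out eq) le) λ ()
        -- Here `y` is in `P`. What remains of `C` has positive stage and is not reached, and the
        -- walk stays in `C` until its last step.
        split false ¬U′y = reach-bound attached Cy s g g-inj (λ i → convert (reached i))
          where
          Cy : C y ≡ true
          Cy = P⊆C (Bool.¬-not (λ ¬Py → true≢false (∖-intro {U} {P} Uy ¬Py) ¬U′y))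
          convert : ∀ {u} → StageReach U t y u → (C ∖ P) u ≡ false × Reach C y u
          convert {u} (le , a , a≤r , o) =
            ≢true⇒≡false (λ d → late (∖-true {C} {P} d) le) , a , a≤r , out-closed K (λ _ → proj₁) Cy o
            where
            late : C u ≡ true × P u ≡ false → ¬ (U u ≡ false ⊎ t u ≤ t y)
            late (Cu , _) (inj₁ ¬Uu) = true≢false (K.inside u Cu) ¬Uu
            late (Cu , ¬Pu) (inj₂ le) = contradiction
              (subst₂ _≤_ (t-in (∖-intro {U} {P} (K.inside u Cu) ¬Pu)) (t-out ¬U′y) le) λ ()

    initial : ∀ y → Placed (λ _ → true) y
    initial y with component (λ _ → true) y refl
    ... | C , Cy , K = C , Cy , K , record
      { M = record
        { root = λ _ → nothing ; tr = λ _ → nothing ; lab = λ _ → none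
        ; root-v = refl ; core-rooted = λ () ; tr-edge = λ () ; tr-valid = λ () ; rest-tr = λ () }
      -- A placeholder: no core exists yet.
      ; q = λ _ → y
      ; attached = record
        { q-core = λ ()
        ; fresh = λ _ → refl
        ; boundary = λ where
            (inj₁ Cx) ¬Cx → contradiction ¬Cx (true≢false Cx)
            (inj₂ (z , Cz , zx)) ¬Cx →
              contradiction ¬Cx (true≢false (Component.closed K _ _ Cz refl zx))
        ; iso = λ ()
        ; cover = λ () }
      ; touches = λ () }

    path-out : ∀ {P : V → Set} ℓ (x : Fin (suc ℓ) → V) →
               (∀ i → Adj G (x (inject₁ i)) (x (suc i))) → (∀ i → toℕ i < ℓ → P (x i)) →
               Out P ℓ (x zero) (x (fromℕ ℓ))
    path-out zero x adjacent inP = done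
    path-out (suc ℓ) x adjacent inP = hop (inP zero z<s) (adjacent zero)
      (path-out ℓ (x ∘ suc) (adjacent ∘ suc) (λ i lt → inP (suc i) (s≤s lt)))

    -- `L` refines the stages, so a path witnessing strong reachability meets, before its end, no
    -- stage earlier than that of its start.
    colouring : ¬ IsMinor H G → ColLe r G bound
    colouring noMinor = L , λ y s g g-inj reach →
      proj₂ staged y refl s g g-inj (λ i → convert (reach i))
      where
      staged = stages noMinor _ (λ _ → true) ≤-refl (λ y _ → initial y)
      t = proj₁ staged
      L = proj₁ (linear-extension t)
      L-mono = proj₂ (linear-extension t)
      convert : ∀ {y u} → SReach r G L y u → StageReach (λ _ → true) t y u
      convert (ℓ , ℓ≤r , P , refl , refl , u≤y , inner) =
        inj₂ (L-mono _ _ u≤y) , ℓ , ℓ≤r , path-out ℓ (vtx P) (cons P) later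
        where
        later : ∀ i → toℕ i < ℓ → true ≡ true × t (vtx P zero) ≤ t (vtx P i)
        later zero _ = refl , ≤-refl
        later (suc i) lt = refl , L-mono _ _ (<⇒≤ (inner (suc i) z<s lt))

theorem1p2 : (H : Graph) (v : Fin (n H)) (G : Graph) → ¬ IsMinor H G →
    (r : ℕ) → 1 ≤ r →
    ColLe r G (edgesMinus H v * (2 * r + 1) + isolatedMinus H v)
theorem1p2 H v G noMinor r 1≤r = Models.Count.colouring H v G r 1≤r noMinor
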